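{- Let $a,b,c,d,e\in\mathbb{Z}$ and $g(z)=z^6+az^4+bz^3+cz^2+dz+e$. If there are infinitely many rational points on the curve $C: v^2=s^4-12as^2+48bs+6(a^2-12c)$, in particular if $b\neq 0$ and $a\equiv 1\pmod 2$, then the equation $$x^2-y^3-g(z)=t$$ has infinitely many solutions $(x,y,z)$ in the ring of polynomials $\mathbb{Q}[t]$.
   Context: Here $t$ is a variable, and a solution in $\mathbb{Q}[t]$ is a triple $(x,y,z)\in\mathbb{Q}[t]^3$ for which the equation holds identically in $\mathbb{Q}[t]$. The phrase "in particular" means that the conclusion is also asserted whenever $b\neq 0$ and $a$ is odd (in which case $C$ has infinitely many rational points). -}

module Defs where

open import Algebra.Bundles.Raw using (RawRing)
import Algebra.Definitions.RawSemiring as RawSemiringDefs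
open import Data.Integer.Base using (ℤ)
open import Data.List.Base using (List; []; _∷_; map)
import Data.List.Membership.Setoid as Membership
open import Data.Nat.Base using (ℕ; zero; suc)
open import Data.Product.Base using (_×_; _,_; ∃-syntax)
open import Data.Product.Relation.Binary.Pointwise.NonDependent using (×-setoid)
open import Data.Rational.Base as ℚ using (ℚ; 0ℚ; 1ℚ)
open import Level using (Level; 0ℓ; _⊔_)
open import Relation.Binary.Bundles using (Setoid)
open import Relation.Binary.PropositionalEquality.Core using (_≡_; refl; sym; trans)
open import Relation.Binary.PropositionalEquality.Properties using (setoid)
open import Relation.Unary using (Pred)

-- A subset P of a setoid is infinite when every finite list of elements misses
-- some element of P.  When _≈_ is decidable, as it is for both setoids below,
-- this is equivalent to the existence of an injective sequence in P.
Infinite : {c ℓ p : Level} (S : Setoid c ℓ) → Pred (Setoid.Carrier S) p → Set (c ⊔ ℓ ⊔ p)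
Infinite S P = ∀ (xs : List Carrier) → ∃[ x ] (P x × x ∉ xs)
  where
  open Setoid S using (Carrier)
  open Membership S using (_∉_)

fromℤ : ℤ → ℚ
fromℤ i = i ℚ./ 1

-- The list q₀ ∷ q₁ ∷ … ∷ qₙ ∷ [] stands for q₀ + q₁ t + … + qₙ tⁿ; trailing
-- zeros are allowed, so equality of polynomials is _≈_ and not _≡_.
ℚ[t] : Set
ℚ[t] = List ℚ

coeff : ℚ[t] → ℕ → ℚ
coeff []      _       = 0ℚ
coeff (q ∷ p) zero    = q
coeff (q ∷ p) (suc i) = coeff p i

infix 4 _≈_

record _≈_ (p q : ℚ[t]) : Set where
  constructor mk≈
  field coeff-≡ : ∀ i → coeff p i ≡ coeff q i

open _≈_ public

ℚ[t]-setoid : Setoid 0ℓ 0ℓ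
ℚ[t]-setoid = record
  { Carrier       = ℚ[t]
  ; _≈_           = _≈_
  ; isEquivalence = record
    { refl  = mk≈ λ _ → refl
    ; sym   = λ e → mk≈ λ i → sym (coeff-≡ e i)
    ; trans = λ e f → mk≈ λ i → trans (coeff-≡ e i) (coeff-≡ f i)
    }
  }

const : ℚ → ℚ[t]
const q = q ∷ []

t : ℚ[t]
t = 0ℚ ∷ 1ℚ ∷ []

infix  8 -_
infixl 7 _*_
infixl 6 _+_ _-_

_+_ : ℚ[t] → ℚ[t] → ℚ[t]
[]      + r       = r
(q ∷ p) + []      = q ∷ p
(q ∷ p) + (s ∷ r) = (q ℚ.+ s) ∷ (p + r)

-_ : ℚ[t] → ℚ[t]
- p = map (λ q → ℚ.- q) p

_-_ : ℚ[t] → ℚ[t] → ℚ[t]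
p - r = p + (- r)

-- (q + t p) r = q r + t (p r)
_*_ : ℚ[t] → ℚ[t] → ℚ[t]
[]      * r = []
(q ∷ p) * r = map (λ s → q ℚ.* s) r + (0ℚ ∷ (p * r))

ℚ[t]-rawRing : RawRing 0ℓ 0ℓ
ℚ[t]-rawRing = record
  { Carrier = ℚ[t]
  ; _≈_     = _≈_
  ; _+_     = _+_
  ; _*_     = _*_
  ; -_      = -_
  ; 0#      = []
  ; 1#      = const 1ℚ
  }

open RawSemiringDefs (RawRing.rawSemiring ℚ[t]-rawRing) public using (_^_)
open RawSemiringDefs ℚ.+-*-rawSemiring public using () renaming (_^_ to _^ℚ_)

ℚ²-setoid : Setoid 0ℓ 0ℓ
ℚ²-setoid = ×-setoid (setoid ℚ) (setoid ℚ)

-- Affine points only; the points at infinity do not affect infinitude.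
OnC : (a b c : ℤ) → Pred (ℚ × ℚ) 0ℓ
OnC a b c (s , v) =
  v ^ℚ 2 ≡ s ^ℚ 4 ℚ.- num 12 ℚ.* A ℚ.* s ^ℚ 2 ℚ.+ num 48 ℚ.* B ℚ.* s
           ℚ.+ num 6 ℚ.* (A ^ℚ 2 ℚ.- num 12 ℚ.* C)
  where
  num : ℕ → ℚ
  num n = fromℤ (ℤ.pos n)
  A B C : ℚ
  A = fromℤ a
  B = fromℤ b
  C = fromℤ c

g : (a b c d e : ℤ) → ℚ[t] → ℚ[t]
g a b c d e z =
  z ^ 6 + k a * z ^ 4 + k b * z ^ 3 + k c * z ^ 2 + k d * z + k e
  where
  k : ℤ → ℚ[t]
  k i = const (fromℤ i)

ℚ[t]³-setoid : Setoid 0ℓ 0ℓ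
ℚ[t]³-setoid = ×-setoid ℚ[t]-setoid (×-setoid ℚ[t]-setoid ℚ[t]-setoid)

IsSolution : (a b c d e : ℤ) → Pred (ℚ[t] × ℚ[t] × ℚ[t]) 0ℓ
IsSolution a b c d e (x , y , z) = x ^ 2 - y ^ 3 - g a b c d e z ≈ t

{-# OPTIONS --safe #-}

-- Solutions.  If X, Y ∈ ℚ[Z] satisfy X² - Y³ - g = ℓ Z + f with ℓ ≠ 0, then Z = (t - f) / ℓ gives a
-- solution.  Matching the coefficients of Z⁶, …, Z² yields a one-parameter family of such pairs for
-- all a, b, c, d, e:
--   X = Z³ + p Z + q,           Y = s Z + w       unless a = c = d = 0,
--   X = α Z² + β Z + γ,         Y = - Z² + α²/3   if a = c = d = 0 ≠ b,
--   X = 3Z³ + 12k Z² + …,       Y = 2Z² + 6k Z + 6k²   if a = b = c = d = 0.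
-- The parameter is recovered from Y = y ∘ z⁻¹, so infinitely many solutions are distinct.
--
-- Points of C.  With P = ∞₊ - ∞₋ the point s = (5a² + 12c) / 8b is ∞₊ + P.  For a odd it is 2-adically
-- close to ∞₋, where tangent doubling with origin ∞₋ takes s to about s / 2; repeated doubling thus
-- produces points whose s-coordinates have unbounded powers of 2 in the denominator.
module Submission where

open import Data.Integer.Base as ℤ using (ℤ; +_; 0ℤ; 1ℤ)
import Data.Integer.Properties as ℤₚ
open import Data.Integer.Divisibility.Signed using (_∣_; divides; ∣⇒∣ᵤ; ∣-trans; ∣-refl; ∣m∣n⇒∣m+n; ∣m∣n⇒∣m-n; ∣m⇒∣m*n; ∣n⇒∣m*n; *-monoʳ-∣)
open import Data.Integer.Tactic.RingSolver using (solve-∀)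
open import Data.List.Base using (List; []; _∷_; map; length)
import Data.List.Membership.Setoid as Membership
open import Data.List.Relation.Unary.Any using (here; there)
open import Data.Nat.ListAction using (sum)
open import Data.Nat.Base as ℕ using (ℕ; zero; suc; z≤n; s≤s)
import Data.Nat.Divisibility as ℕ∣
import Data.Nat.Properties as ℕₚ
open import Data.Product.Base using (_×_; _,_; ∃-syntax)
open import Data.Rational.Base as ℚ using (ℚ; 0ℚ; 1ℚ; ½; mkℚ; ↥_; ↧_; ↧ₙ_)
import Data.Rational.Properties as ℚₚ
open import Data.Rational.Solver using (module +-*-Solver)
open import Data.Rational.Unnormalised.Base as ℚᵘ using (mkℚᵘ; *≡*)
import Data.Rational.Unnormalised.Properties as ℚᵘₚ
open import Data.Sum.Base using (_⊎_; inj₁; inj₂; [_,_]′)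
open import Level using (Level)
open import Relation.Binary.Bundles using (Setoid)
open import Relation.Binary.PropositionalEquality
  using (_≡_; _≢_; refl; sym; trans; cong; cong₂; subst; subst₂; module ≡-Reasoning)
open import Relation.Nullary using (¬_; Dec; yes; no; contradiction)
open import Relation.Unary using (Pred)

import Defs as P
open P using (Infinite; fromℤ; ℚ[t]; coeff; const; t; mk≈; coeff-≡; _≈_; _^ℚ_; _^_;
  ℚ²-setoid; OnC; g; ℚ[t]³-setoid; IsSolution)

-- Infinitude from an unbounded size function.

module _ {c ℓ p : Level} (S : Setoid c ℓ) (P : Pred (Setoid.Carrier S) p) where

  open Setoid S using (Carrier) renaming (_≈_ to _∼_)
  open Membership S using (_∈_)

  -- A witness larger than the total size of the listed elements cannot be among them: membership
  -- yields an equivalent listed `y`, whose size is at most the total. Since `size` need not respect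
  -- the setoid equality, the lower bound is demanded of every representative `y` of `x`.
  infinite-if-unbounded : (size : Carrier → ℕ) →
    (∀ N → ∃[ x ] (P x × (∀ y → x ∼ y → N ℕ.≤ size y))) → Infinite S P
  infinite-if-unbounded size unbounded xs =
    let x , Px , big = unbounded (suc (sum (map size xs)))
    in  x , Px , λ x∈xs → ℕₚ.1+n≰n (≤-sum x∈xs big)
    where
    ≤-sum : ∀ {x N ys} → x ∈ ys → (∀ y → x ∼ y → N ℕ.≤ size y) → N ℕ.≤ sum (map size ys)
    ≤-sum (here {x = y} x∼y) big = ℕₚ.≤-trans (big y x∼y) (ℕₚ.m≤m+n (size y) _)
    ≤-sum (there {x = y} x∈ys) big = ℕₚ.≤-trans (≤-sum x∈ys big) (ℕₚ.m≤n+m _ (size y))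

-- Points of C in integral coordinates, and their 2-adic behaviour under doubling.

module IntegralPoints where

  open import Data.Integer.Base using (_+_; _*_; _-_; -_)

  Odd : ℤ → Set
  Odd i = + 2 ∣ i - 1ℤ

  odd-* : ∀ i j → Odd i → Odd j → Odd (i * j)
  odd-* i j oi oj = subst (+ 2 ∣_) (eq i j) (∣m∣n⇒∣m+n (∣m⇒∣m*n j oi) oj)
    where
    eq : ∀ i j → (i - 1ℤ) * j + (j - 1ℤ) ≡ i * j - 1ℤ
    eq = solve-∀

  -- All parity checks below take this form: the integer is rewritten as a visibly odd term plus
  -- twice an explicit expression.
  odd-+2* : ∀ i k → Odd i → Odd (i + + 2 * k)
  odd-+2* i k oi = subst (+ 2 ∣_) (eq i k) (∣m∣n⇒∣m+n oi (∣m⇒∣m*n k ∣-refl))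
    where
    eq : ∀ i k → i - 1ℤ + + 2 * k ≡ i + + 2 * k - 1ℤ
    eq = solve-∀

  odd⇒≢0 : ∀ i → Odd i → i ≢ 0ℤ
  odd⇒≢0 _ o refl with ℕ∣.∣1⇒≡1 (∣⇒∣ᵤ o)
  ... | ()

  *-≢0 : ∀ i j → i ≢ 0ℤ → j ≢ 0ℤ → i * j ≢ 0ℤ
  *-≢0 i j i≢0 j≢0 ij≡0 = [ i≢0 , j≢0 ]′ (ℤₚ.i*j≡0⇒i≡0∨j≡0 i ij≡0)

  2^_ : ℕ → ℤ
  2^ j = + (2 ℕ.^ j)

  2^-suc : ∀ j → 2^ (suc j) ≡ + 2 * 2^ j
  2^-suc j = ℤₚ.pos-* 2 (2 ℕ.^ j)

  -- Induction on `j`. With m = 1 + 2k one has i = mi - k(2i), and the induction hypothesis 2^j ∣ i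
  -- makes 2i divisible by 2^(j+1).
  2^j∣odd*i⇒2^j∣i : ∀ j m i → Odd m → 2^ j ∣ m * i → 2^ j ∣ i
  2^j∣odd*i⇒2^j∣i zero    m i _ _ = divides i (sym (ℤₚ.*-identityʳ i))
  2^j∣odd*i⇒2^j∣i (suc j) m i om@(divides k m-1≡k*2) ∣mi = subst (2^ (suc j) ∣_) eq′
    (∣m∣n⇒∣m-n ∣mi (∣n⇒∣m*n k (subst (_∣ + 2 * i) (sym (2^-suc j)) (*-monoʳ-∣ (+ 2) 2^j∣i))))
    where
    2^j∣i : 2^ j ∣ i
    2^j∣i = 2^j∣odd*i⇒2^j∣i j m i om
      (∣-trans (subst (2^ j ∣_) (sym (2^-suc j)) (∣n⇒∣m*n (+ 2) ∣-refl)) ∣mi)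
    eq : ∀ m k i → m * i - k * (+ 2 * i) ≡ (m - 1ℤ) * i - k * + 2 * i + i
    eq = solve-∀
    cancel : ∀ x i → x * i - x * i + i ≡ i
    cancel = solve-∀
    eq′ : m * i - k * (+ 2 * i) ≡ i
    eq′ = trans (eq m k i) (trans (cong (λ x → x * i - k * + 2 * i + i) m-1≡k*2) (cancel (k * + 2) i))

  -- (m, n, h) stands for the point s = m / 2n, v = (m² - 2h) / 4n² of C.
  OnCurve : (a b c m n h : ℤ) → Set
  OnCurve a b c m n h = h * (h - m * m) ≡
    n * n * (- + 12 * a * (m * m) + + 96 * b * (m * n) + + 24 * (a * a - + 12 * c) * (n * n))

  -- As `m` is odd, the powers of 2 in `n` survive in the denominator of s. As `h` is odd, the curve
  -- equation makes h - m² divisible by 4^j; thus v is 2-adically close to -s², on the branch of ∞₋.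
  record DyadicPoint (a b c : ℤ) (j : ℕ) : Set where
    field
      m n h   : ℤ
      m-odd   : Odd m
      h-odd   : Odd h
      n≢0     : n ≢ 0ℤ
      2^j∣n   : 2^ j ∣ n
      onCurve : OnCurve a b c m n h

  -- The parabola v = -s² + 6a agrees with C so closely at infinity that intersecting them leaves
  -- the linear equation 48bs = 30a² + 72c. Its root is m / 2n with n = 4b, and `h` encodes v = -s²
  -- + 6a.
  initialPoint : ∀ a b c → b ≢ 0ℤ → Odd a → DyadicPoint a b c 0
  initialPoint a b c b≢0 a-odd = record
    { m       = m
    ; n       = + 4 * b
    ; h       = m * m - + 192 * a * (b * b)
    ; m-odd   = m-odd
    ; h-odd   = subst Odd (h-eq a b m) (odd-+2* (m * m) (- (+ 96 * a * (b * b))) (odd-* m m m-odd m-odd))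
    ; n≢0     = *-≢0 (+ 4) b (λ ()) b≢0
    ; 2^j∣n   = divides (+ 4 * b) (sym (ℤₚ.*-identityʳ (+ 4 * b)))
    ; onCurve = curve-eq a b c
    }
    where
    m = + 5 * (a * a) + + 12 * c
    m-eq : ∀ a c → a * a + + 2 * (+ 2 * (a * a) + + 6 * c) ≡ + 5 * (a * a) + + 12 * c
    m-eq = solve-∀
    h-eq : ∀ a b m → m * m + + 2 * (- (+ 96 * a * (b * b))) ≡ m * m - + 192 * a * (b * b)
    h-eq = solve-∀
    m-odd : Odd m
    m-odd = subst Odd (m-eq a c) (odd-+2* (a * a) (+ 2 * (a * a) + + 6 * c) (odd-* a a a-odd a-odd))
    curve-eq : ∀ a b c →
      let m = + 5 * (a * a) + + 12 * c
          n = + 4 * b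
          h = m * m - + 192 * a * (b * b)
      in h * (h - m * m) ≡
         n * n * (- + 12 * a * (m * m) + + 96 * b * (m * n) + + 24 * (a * a - + 12 * c) * (n * n))
    curve-eq = solve-∀

  -- The parabola v = s² + k s + l tangent to C at the given point meets C in one further point;
  -- its conjugate is the new point.  After clearing denominators its s-coordinate is m′ / 2n′,
  -- where X = 2rκm is the (rescaled) double root of a monic cubic with quadratic coefficient e₂.
  doublePoint : ∀ {a b c j} → DyadicPoint a b c j → DyadicPoint a b c (suc j)
  doublePoint {a} {b} {c} {j} point = record
    { m       = m′
    ; n       = n′
    ; h       = h′
    ; m-odd   = m′-odd
    ; h-odd   = subst Odd (h′-eq m′ (κ * κ) (m′ + μ * r))
                  (odd-+2* (m′ * m′) (+ 2 * (κ * κ) * (m′ + μ * r)) (odd-* m′ m′ m′-odd m′-odd))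
    ; n≢0     = *-≢0 (+ 2 * r * κ) n
                  (*-≢0 (+ 2 * r) κ (*-≢0 (+ 2) r (λ ()) (odd⇒≢0 r r-odd)) (odd⇒≢0 κ κ-odd)) n≢0
    ; 2^j∣n   = subst₂ _∣_ (sym (2^-suc j)) (n′-eq r κ n)
                  (*-monoʳ-∣ (+ 2) (∣n⇒∣m*n (r * κ) 2^j∣n))
    ; onCurve = ℤₚ.i-j≡0⇒i≡j _ _ (trans (taylor a b (a * a - + 12 * c) n m κ μ r m′) vanishes)
    }
    where
    open DyadicPoint point
    r κ μ e₂ m′ n′ h′ : ℤ
    -- Here v = r / 4n², and the tangent parabola has k = 2κ / rn and l = μ / 2rn²: `κ` comes from
    -- the slope of C at the point, `μ` from passing through it. By Vieta, X, X and `m′` are the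
    -- roots of the cubic. `h′` encodes v′ = -(s′² + k s′ + l), the minus sign being the
    -- conjugation.
    r  = m * m - + 2 * h
    κ  = m * h - + 12 * a * (m * (n * n)) + + 48 * b * (n * n * n)
    μ  = - (r * h) - + 2 * (κ * m)
    e₂ = μ * r + + 4 * (κ * κ) + + 12 * a * (r * r) * (n * n)
    m′ = - e₂ - + 4 * (r * κ * m)
    n′ = + 2 * r * κ * n
    h′ = m′ * m′ + + 4 * (κ * κ) * (m′ + μ * r)

    -- Modulo 2 one has r ≡ m², κ ≡ mh, μ ≡ rh, m′ ≡ μr and h′ ≡ m′². All of these stay odd, while
    -- n′ = 2rκn gains one factor 2.
    r-eq : ∀ m h → m * m + + 2 * (- h) ≡ m * m - + 2 * h
    r-eq = solve-∀
    r-odd : Odd r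
    r-odd = subst Odd (r-eq m h) (odd-+2* (m * m) (- h) (odd-* m m m-odd m-odd))

    κ-eq : ∀ a b m n h →
      m * h + + 2 * (+ 24 * b * (n * n * n) - + 6 * a * (m * (n * n)))
      ≡ m * h - + 12 * a * (m * (n * n)) + + 48 * b * (n * n * n)
    κ-eq = solve-∀
    κ-odd : Odd κ
    κ-odd = subst Odd (κ-eq a b m n h)
      (odd-+2* (m * h) (+ 24 * b * (n * n * n) - + 6 * a * (m * (n * n))) (odd-* m h m-odd h-odd))

    μ-eq : ∀ κ m x → x + + 2 * (- x - κ * m) ≡ - x - + 2 * (κ * m)
    μ-eq = solve-∀
    μ-odd : Odd μ
    μ-odd = subst Odd (μ-eq κ m (r * h)) (odd-+2* (r * h) (- (r * h) - κ * m) (odd-* r h r-odd h-odd))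

    m′-eq : ∀ a κ n m r x →
      x + + 2 * (- x - + 2 * (κ * κ) - + 6 * a * (r * r) * (n * n) - + 2 * (r * κ * m))
      ≡ - (x + + 4 * (κ * κ) + + 12 * a * (r * r) * (n * n)) - + 4 * (r * κ * m)
    m′-eq = solve-∀
    m′-odd : Odd m′
    m′-odd = subst Odd (m′-eq a κ n m r (μ * r))
      (odd-+2* (μ * r)
        (- (μ * r) - + 2 * (κ * κ) - + 6 * a * (r * r) * (n * n) - + 2 * (r * κ * m))
        (odd-* μ r μ-odd r-odd))

    h′-eq : ∀ m y z → m * m + + 2 * (+ 2 * y * z) ≡ m * m + + 4 * y * z
    h′-eq = solve-∀

    n′-eq : ∀ r κ n → + 2 * (r * κ * n) ≡ + 2 * r * κ * n
    n′-eq = solve-∀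

    -- The defect of the new curve equation is 4κ² times the monic cubic at `m′`, expanded here
    -- about X. The value of the cubic at X is 4r²κ²F₀ and its derivative there is 4rκF₁; `e`
    -- abbreviates a² - 12c.
    taylor : ∀ a b e n m κ μ r m′ →
      let X  = + 2 * r * κ * m
          n′ = + 2 * r * κ * n
          h′ = m′ * m′ + + 4 * (κ * κ) * (m′ + μ * r)
          e₂ = μ * r + + 4 * (κ * κ) + + 12 * a * (r * r) * (n * n)
          F₀ = + 2 * r * κ * (m * m * m) + e₂ * (m * m)
               + m * (+ 4 * κ * μ - + 96 * b * (r * r) * (n * n * n))
               + μ * μ - + 24 * e * (r * r) * (n * n * n * n)
          F₁ = + 3 * r * κ * (m * m) + m * e₂ + + 2 * κ * μ - + 48 * b * (r * r) * (n * n * n)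
      in h′ * (h′ - m′ * m′)
         - n′ * n′ * (- + 12 * a * (m′ * m′) + + 96 * b * (m′ * n′) + + 24 * e * (n′ * n′))
         ≡ + 4 * κ * κ * (+ 4 * r * r * κ * κ * F₀ + (m′ - X) * (+ 4 * r * κ * F₁)
                          + (m′ - X) * (m′ - X) * (m′ + + 2 * X + e₂))
    taylor = solve-∀

    F₀ F₁ : ℤ
    F₀ = + 2 * r * κ * (m * m * m) + e₂ * (m * m)
         + m * (+ 4 * κ * μ - + 96 * b * (r * r) * (n * n * n))
         + μ * μ - + 24 * (a * a - + 12 * c) * (r * r) * (n * n * n * n)
    F₁ = + 3 * r * κ * (m * m) + m * e₂ + + 2 * κ * μ - + 48 * b * (r * r) * (n * n * n)

    -- The choice of `μ` puts the old point on the parabola, whatever its slope, so the cubic at X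
    -- reduces to the old curve equation.
    F₀-eq : ∀ a b e n m h κ r →
      let μ  = - (r * h) - + 2 * (κ * m)
          e₂ = μ * r + + 4 * (κ * κ) + + 12 * a * (r * r) * (n * n)
      in + 2 * r * κ * (m * m * m) + e₂ * (m * m)
         + m * (+ 4 * κ * μ - + 96 * b * (r * r) * (n * n * n))
         + μ * μ - + 24 * e * (r * r) * (n * n * n * n)
         ≡ r * r * (h * (h - m * m)
           - n * n * (- + 12 * a * (m * m) + + 96 * b * (m * n) + + 24 * e * (n * n)))
    F₀-eq = solve-∀
    F₀≡0 : F₀ ≡ 0ℤ
    F₀≡0 = trans (F₀-eq a b (a * a - + 12 * c) n m h κ r)
      (trans (cong (r * r *_) (ℤₚ.i≡j⇒i-j≡0 onCurve)) (ℤₚ.*-zeroʳ (r * r)))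

    -- This is the tangency: `κ` was chosen to make the derivative of the cubic vanish at X.
    F₁-eq : ∀ a b n m h →
      let r  = m * m - + 2 * h
          κ  = m * h - + 12 * a * (m * (n * n)) + + 48 * b * (n * n * n)
          μ  = - (r * h) - + 2 * (κ * m)
          e₂ = μ * r + + 4 * (κ * κ) + + 12 * a * (r * r) * (n * n)
      in + 3 * r * κ * (m * m) + m * e₂ + + 2 * κ * μ - + 48 * b * (r * r) * (n * n * n) ≡ 0ℤ
    F₁-eq = solve-∀

    last-eq : ∀ e x → - e - + 4 * x + + 2 * (+ 2 * x) + e ≡ 0ℤ
    last-eq = solve-∀
    assoc-eq : ∀ r κ m → + 2 * r * κ * m ≡ + 2 * (r * κ * m)
    assoc-eq = solve-∀
    zero-eq : ∀ x y z w → x * (y * 0ℤ + z * (w * 0ℤ) + z * z * 0ℤ) ≡ 0ℤ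
    zero-eq = solve-∀

    X = + 2 * r * κ * m
    vanishes : + 4 * κ * κ * (+ 4 * r * r * κ * κ * F₀ + (m′ - X) * (+ 4 * r * κ * F₁)
                              + (m′ - X) * (m′ - X) * (m′ + + 2 * X + e₂)) ≡ 0ℤ
    vanishes = begin
      + 4 * κ * κ * (+ 4 * r * r * κ * κ * F₀ + (m′ - X) * (+ 4 * r * κ * F₁)
                     + (m′ - X) * (m′ - X) * (m′ + + 2 * X + e₂))
        ≡⟨ cong₂ (λ F y → + 4 * κ * κ * (+ 4 * r * r * κ * κ * F + (m′ - X) * (+ 4 * r * κ * F₁)
                          + (m′ - X) * (m′ - X) * y)) F₀≡0 cubic-sum ⟩
      + 4 * κ * κ * (+ 4 * r * r * κ * κ * 0ℤ + (m′ - X) * (+ 4 * r * κ * F₁)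
                     + (m′ - X) * (m′ - X) * 0ℤ)
        ≡⟨ cong (λ F → + 4 * κ * κ * (+ 4 * r * r * κ * κ * 0ℤ + (m′ - X) * (+ 4 * r * κ * F)
                          + (m′ - X) * (m′ - X) * 0ℤ)) (F₁-eq a b n m h) ⟩
      + 4 * κ * κ * (+ 4 * r * r * κ * κ * 0ℤ + (m′ - X) * (+ 4 * r * κ * 0ℤ)
                     + (m′ - X) * (m′ - X) * 0ℤ)
        ≡⟨ zero-eq (+ 4 * κ * κ) (+ 4 * r * r * κ * κ) (m′ - X) (+ 4 * r * κ) ⟩
      0ℤ ∎
      where
      open ≡-Reasoning
      cubic-sum : m′ + + 2 * X + e₂ ≡ 0ℤ
      cubic-sum = trans (cong (λ x → m′ + + 2 * x + e₂) (assoc-eq r κ m)) (last-eq e₂ (r * κ * m))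

  dyadicPoint : ∀ {a b c} → b ≢ 0ℤ → Odd a → ∀ j → DyadicPoint a b c j
  dyadicPoint {a} {b} {c} b≢0 a-odd zero    = initialPoint a b c b≢0 a-odd
  dyadicPoint             b≢0 a-odd (suc j) = doublePoint (dyadicPoint b≢0 a-odd j)

-- Embedding of the integers in the rationals, total inverses, and signs of squares.

module Rationals where

  open import Data.Rational.Base using (_+_; _*_; _-_; -_)
  open +-*-Solver

  -- Normalisation blocks computation on variables, so this and the next lemmas pass to unnormalised
  -- rationals, where the homomorphism laws are integer identities.
  fromℤ-+ : ∀ i j → fromℤ (i ℤ.+ j) ≡ fromℤ i + fromℤ j
  fromℤ-+ i j = ℚₚ.toℚᵘ-injective (begin
    ℚ.toℚᵘ (fromℤ (i ℤ.+ j))                     ≈⟨ ℚₚ.toℚᵘ-fromℚᵘ (mkℚᵘ (i ℤ.+ j) 0) ⟩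
    mkℚᵘ (i ℤ.+ j) 0                              ≈⟨ *≡* (eq i j) ⟩
    mkℚᵘ i 0 ℚᵘ.+ mkℚᵘ j 0                        ≈⟨ ℚᵘₚ.+-cong (ℚₚ.toℚᵘ-fromℚᵘ (mkℚᵘ i 0)) (ℚₚ.toℚᵘ-fromℚᵘ (mkℚᵘ j 0)) ⟨
    ℚ.toℚᵘ (fromℤ i) ℚᵘ.+ ℚ.toℚᵘ (fromℤ j)        ≈⟨ ℚₚ.toℚᵘ-homo-+ (fromℤ i) (fromℤ j) ⟨
    ℚ.toℚᵘ (fromℤ i + fromℤ j)                    ∎)
    where
    open ℚᵘₚ.≃-Reasoning
    eq : ∀ i j → (i ℤ.+ j) ℤ.* + 1 ≡ (i ℤ.* + 1 ℤ.+ j ℤ.* + 1) ℤ.* + 1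
    eq = solve-∀

  fromℤ-* : ∀ i j → fromℤ (i ℤ.* j) ≡ fromℤ i * fromℤ j
  fromℤ-* i j = ℚₚ.toℚᵘ-injective (begin
    ℚ.toℚᵘ (fromℤ (i ℤ.* j))                     ≈⟨ ℚₚ.toℚᵘ-fromℚᵘ (mkℚᵘ (i ℤ.* j) 0) ⟩
    mkℚᵘ i 0 ℚᵘ.* mkℚᵘ j 0                        ≈⟨ ℚᵘₚ.*-cong (ℚₚ.toℚᵘ-fromℚᵘ (mkℚᵘ i 0)) (ℚₚ.toℚᵘ-fromℚᵘ (mkℚᵘ j 0)) ⟨
    ℚ.toℚᵘ (fromℤ i) ℚᵘ.* ℚ.toℚᵘ (fromℤ j)        ≈⟨ ℚₚ.toℚᵘ-homo-* (fromℤ i) (fromℤ j) ⟨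
    ℚ.toℚᵘ (fromℤ i * fromℤ j)                    ∎)
    where open ℚᵘₚ.≃-Reasoning

  fromℤ-neg : ∀ i → fromℤ (ℤ.- i) ≡ - fromℤ i
  fromℤ-neg i = ℚₚ.toℚᵘ-injective (begin
    ℚ.toℚᵘ (fromℤ (ℤ.- i))      ≈⟨ ℚₚ.toℚᵘ-fromℚᵘ (mkℚᵘ (ℤ.- i) 0) ⟩
    ℚᵘ.- mkℚᵘ i 0               ≈⟨ ℚᵘₚ.-‿cong (ℚₚ.toℚᵘ-fromℚᵘ (mkℚᵘ i 0)) ⟨
    ℚᵘ.- ℚ.toℚᵘ (fromℤ i)       ≈⟨ ℚₚ.toℚᵘ-homo‿- (fromℤ i) ⟨
    ℚ.toℚᵘ (- fromℤ i)          ∎)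
    where open ℚᵘₚ.≃-Reasoning

  fromℤ-injective : ∀ i j → fromℤ i ≡ fromℤ j → i ≡ j
  fromℤ-injective i j eq with ℚₚ.fromℚᵘ-injective {mkℚᵘ i 0} {mkℚᵘ j 0} eq
  ... | *≡* i*1≡j*1 = trans (sym (ℤₚ.*-identityʳ i)) (trans i*1≡j*1 (ℤₚ.*-identityʳ j))

  ↧q*q≡↥q : ∀ q → fromℤ (↧ q) * q ≡ fromℤ (↥ q)
  ↧q*q≡↥q q = ℚₚ.toℚᵘ-injective (begin
    ℚ.toℚᵘ (fromℤ (↧ q) * q)                ≈⟨ ℚₚ.toℚᵘ-homo-* (fromℤ (↧ q)) q ⟩
    ℚ.toℚᵘ (fromℤ (↧ q)) ℚᵘ.* ℚ.toℚᵘ q      ≈⟨ ℚᵘₚ.*-congʳ (ℚₚ.toℚᵘ-fromℚᵘ (mkℚᵘ (↧ q) 0)) ⟩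
    mkℚᵘ (↧ q) 0 ℚᵘ.* ℚ.toℚᵘ q              ≈⟨ cross q ⟩
    mkℚᵘ (↥ q) 0                            ≈⟨ ℚₚ.toℚᵘ-fromℚᵘ (mkℚᵘ (↥ q) 0) ⟨
    ℚ.toℚᵘ (fromℤ (↥ q))                    ∎)
    where
    open ℚᵘₚ.≃-Reasoning
    eq : ∀ n d → d ℤ.* n ℤ.* + 1 ≡ n ℤ.* d
    eq = solve-∀
    cross : ∀ q → mkℚᵘ (↧ q) 0 ℚᵘ.* ℚ.toℚᵘ q ℚᵘ.≃ mkℚᵘ (↥ q) 0
    cross (mkℚ n d _) = *≡* (trans (eq n (+ suc d)) (cong (λ x → n ℤ.* + suc x) (sym (ℕₚ.+-identityʳ d))))

  num : ℕ → ℚ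
  num n = fromℤ (+ n)

  num-+ : ∀ m n → num (m ℕ.+ n) ≡ num m + num n
  num-+ m n = trans (cong fromℤ (ℤₚ.pos-+ m n)) (fromℤ-+ (+ m) (+ n))

  num-* : ∀ m n → num (m ℕ.* n) ≡ num m * num n
  num-* m n = trans (cong fromℤ (ℤₚ.pos-* m n)) (fromℤ-* (+ m) (+ n))

  num-injective : ∀ m n → num m ≡ num n → m ≡ n
  num-injective m n eq = ℤₚ.+-injective (fromℤ-injective (+ m) (+ n) eq)

  -- The numerator is `n` times the positive denominator, so the bound follows without computing the
  -- normal form.
  n≤∣↥num∣ : ∀ n → n ℕ.≤ ℤ.∣ ↥ num n ∣
  n≤∣↥num∣ n = ℕₚ.≤-trans (ℕₚ.m≤n*m n (↧ₙ num n))
    (ℕₚ.≤-reflexive (trans (sym (ℤₚ.abs-* (↧ num n) (+ n))) (cong ℤ.∣_∣ eq)))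
    where
    eq : ↧ num n ℤ.* + n ≡ ↥ num n
    eq = fromℤ-injective _ _ (trans (fromℤ-* (↧ num n) (+ n)) (↧q*q≡↥q (num n)))

  -- Totalised with value 0 at 0, so that formulas containing inverses need no nonzero instance;
  -- `*-inv` restores the law where it holds.
  inv : ℚ → ℚ
  inv q with q ℚₚ.≟ 0ℚ
  ... | yes _   = 0ℚ
  ... | no q≢0 = (ℚ.1/ q) {{ℚ.≢-nonZero q≢0}}

  *-inv : ∀ q → q ≢ 0ℚ → q * inv q ≡ 1ℚ
  *-inv q q≢0 with q ℚₚ.≟ 0ℚ
  ... | yes q≡0 = contradiction q≡0 q≢0
  ... | no q≢0′ = ℚₚ.*-inverseʳ q {{ℚ.≢-nonZero q≢0′}}

  inv-≢0 : ∀ q → q ≢ 0ℚ → inv q ≢ 0ℚ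
  inv-≢0 q q≢0 inv≡0 = ℚₚ.1≢0
    (trans (sym (*-inv q q≢0)) (trans (cong (q *_) inv≡0) (ℚₚ.*-zeroʳ q)))

  *-zero-cancel : ∀ p q → p ≢ 0ℚ → p * q ≡ 0ℚ → q ≡ 0ℚ
  *-zero-cancel p q p≢0 pq≡0 = begin
    q                    ≡⟨ ℚₚ.*-identityˡ q ⟨
    1ℚ * q               ≡⟨ cong (_* q) (*-inv p p≢0) ⟨
    p * inv p * q        ≡⟨ solve 3 (λ p i q → p :* i :* q := i :* (p :* q)) refl p (inv p) q ⟩
    inv p * (p * q)      ≡⟨ cong (inv p *_) pq≡0 ⟩
    inv p * 0ℚ           ≡⟨ ℚₚ.*-zeroʳ (inv p) ⟩
    0ℚ                   ∎
    where open ≡-Reasoning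

  *-≢0 : ∀ p q → p ≢ 0ℚ → q ≢ 0ℚ → p * q ≢ 0ℚ
  *-≢0 p q p≢0 q≢0 pq≡0 = q≢0 (*-zero-cancel p q p≢0 pq≡0)

  p-q≡0⇒p≡q : ∀ p q → p - q ≡ 0ℚ → p ≡ q
  p-q≡0⇒p≡q p q eq = begin
    p              ≡⟨ solve 2 (λ p q → p := p :- q :+ q) refl p q ⟩
    p - q + q      ≡⟨ cong (_+ q) eq ⟩
    0ℚ + q         ≡⟨ ℚₚ.+-identityˡ q ⟩
    q              ∎
    where open ≡-Reasoning

  square-nonNegative : ∀ p → 0ℚ ℚ.≤ p * p
  square-nonNegative p with ℚₚ.≤-total 0ℚ p
  ... | inj₁ 0≤p = ℚₚ.nonNegative⁻¹ (p * p)
    {{ℚₚ.nonNeg*nonNeg⇒nonNeg p {{ℚ.nonNegative 0≤p}} p {{ℚ.nonNegative 0≤p}}}}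
  ... | inj₂ p≤0 = ℚₚ.nonNegative⁻¹ (p * p)
    {{ℚₚ.nonPos*nonPos⇒nonPos p {{ℚ.nonPositive p≤0}} p {{ℚ.nonPositive p≤0}}}}

  #_ : ∀ {n} → ℕ → Polynomial n
  # i = con (num i)

-- Infinitely many rational points on C.

module CurvePoints where

  open import Data.Rational.Base using (_+_; _*_; _-_; -_)
  open +-*-Solver
  open IntegralPoints
  open Rationals hiding (*-≢0)

  private
    -- A record rather than a synonym, so that i can be inferred from the type i ↦ p.
    record _↦_ (i : ℤ) (p : ℚ) : Set where
      constructor [_]
      field image : fromℤ i ≡ p
    open _↦_

    ⟨_⟩ : ∀ i → i ↦ fromℤ i
    ⟨ i ⟩ = [ refl ]

    _⊕_ : ∀ {i j p q} → i ↦ p → j ↦ q → (i ℤ.+ j) ↦ (p + q)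
    _⊕_ {i} {j} [ i≡ ] [ j≡ ] = [ trans (fromℤ-+ i j) (cong₂ _+_ i≡ j≡) ]

    _⊗_ : ∀ {i j p q} → i ↦ p → j ↦ q → (i ℤ.* j) ↦ (p * q)
    _⊗_ {i} {j} [ i≡ ] [ j≡ ] = [ trans (fromℤ-* i j) (cong₂ _*_ i≡ j≡) ]

    ⊖_ : ∀ {i p} → i ↦ p → (ℤ.- i) ↦ (- p)
    ⊖_ {i} [ i≡ ] = [ trans (fromℤ-neg i) (cong -_ i≡) ]

    infix  4 _↦_
    infixl 6 _⊕_
    infixl 7 _⊗_
    infix  8 ⊖_

  module _ {a b c : ℤ} {j : ℕ} (point : DyadicPoint a b c j) where

    open DyadicPoint point
    private
      A = fromℤ a
      B = fromℤ b
      C = fromℤ c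
      M = fromℤ m
      N = fromℤ n
      H = fromℤ h

    curve-in-ℚ : H * (H + - (M * M)) ≡ N * N * (- num 12 * A * (M * M) + num 96 * B * (M * N)
                   + num 24 * (A * A + - (num 12 * C)) * (N * N))
    curve-in-ℚ = trans (sym (image (⟨ h ⟩ ⊗ (⟨ h ⟩ ⊕ ⊖ (⟨ m ⟩ ⊗ ⟨ m ⟩))))) (trans (cong fromℤ onCurve)
      (image (⟨ n ⟩ ⊗ ⟨ n ⟩ ⊗ (⊖ ⟨ + 12 ⟩ ⊗ ⟨ a ⟩ ⊗ (⟨ m ⟩ ⊗ ⟨ m ⟩) ⊕ ⟨ + 96 ⟩ ⊗ ⟨ b ⟩ ⊗ (⟨ m ⟩ ⊗ ⟨ n ⟩)
        ⊕ ⟨ + 24 ⟩ ⊗ (⟨ a ⟩ ⊗ ⟨ a ⟩ ⊕ ⊖ (⟨ + 12 ⟩ ⊗ ⟨ c ⟩)) ⊗ (⟨ n ⟩ ⊗ ⟨ n ⟩)))))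

    private
      2N≢0 : num 2 * N ≢ 0ℚ
      2N≢0 = Rationals.*-≢0 (num 2) N (λ ()) λ N≡0 → n≢0 (fromℤ-injective n 0ℤ N≡0)
      w = inv (num 2 * N)
      2Nw≡1 : num 2 * N * w ≡ 1ℚ
      2Nw≡1 = *-inv (num 2 * N) 2N≢0

    s-coordinate v-coordinate : ℚ
    s-coordinate = M * w
    v-coordinate = (M * M - num 2 * H) * (w * w)

    -- The quartic is homogenised by u = 2Nw, so that the relation 2Nw = 1 enters in one
    -- substitution between two ring identities. The trailing factors `1ℚ` come from unfolding
    -- `_^ℚ_`.
    point-onC : OnC a b c (s-coordinate , v-coordinate)
    point-onC = begin
      v-coordinate * (v-coordinate * 1ℚ)
        ≡⟨ square-eq M H w ⟩
      s * (s * (s * (s * 1ℚ))) + num 4 * (w * w * w * w) * (H * (H + - (M * M)))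
        ≡⟨ cong (λ x → s * (s * (s * (s * 1ℚ))) + num 4 * (w * w * w * w) * x) curve-in-ℚ ⟩
      s * (s * (s * (s * 1ℚ))) + num 4 * (w * w * w * w) * (N * N * (- num 12 * A * (M * M)
        + num 96 * B * (M * N) + num 24 * (A * A + - (num 12 * C)) * (N * N)))
        ≡⟨ homogenise A B C M N w ⟩
      curve (num 2 * N * w)
        ≡⟨ cong curve 2Nw≡1 ⟩
      curve 1ℚ
        ≡⟨ dehomogenise A B C s ⟩
      s * (s * (s * (s * 1ℚ))) - num 12 * A * (s * (s * 1ℚ)) + num 48 * B * s
        + num 6 * (A * (A * 1ℚ) - num 12 * C) ∎
      where
      open ≡-Reasoning
      s = s-coordinate
      curve : ℚ → ℚ
      curve u = s * (s * (s * (s * 1ℚ))) - u * u * (num 12 * A * (s * s)) + u * u * u * (num 48 * B * s)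
        + u * u * u * u * (num 6 * (A * A - num 12 * C))
      square-eq : ∀ M H w → let v = (M * M - num 2 * H) * (w * w)
                                s = M * w in
        v * (v * 1ℚ) ≡ s * (s * (s * (s * 1ℚ))) + num 4 * (w * w * w * w) * (H * (H + - (M * M)))
      square-eq = solve 3 (λ M H w → let v = (M :* M :- # 2 :* H) :* (w :* w)
                                         s = M :* w in
        v :* (v :* con 1ℚ) := s :* (s :* (s :* (s :* con 1ℚ))) :+ # 4 :* (w :* w :* w :* w) :* (H :* (H :+ :- (M :* M)))) refl
      homogenise : ∀ A B C M N w → let s = M * w
                                       u = num 2 * N * w in
        s * (s * (s * (s * 1ℚ))) + num 4 * (w * w * w * w) * (N * N * (- num 12 * A * (M * M)
          + num 96 * B * (M * N) + num 24 * (A * A + - (num 12 * C)) * (N * N)))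
        ≡ s * (s * (s * (s * 1ℚ))) - u * u * (num 12 * A * (s * s)) + u * u * u * (num 48 * B * s)
          + u * u * u * u * (num 6 * (A * A - num 12 * C))
      homogenise = solve 6 (λ A B C M N w → let s = M :* w
                                                u = # 2 :* N :* w in
        s :* (s :* (s :* (s :* con 1ℚ))) :+ # 4 :* (w :* w :* w :* w) :* (N :* N :* (:- # 12 :* A :* (M :* M)
          :+ # 96 :* B :* (M :* N) :+ # 24 :* (A :* A :+ :- (# 12 :* C)) :* (N :* N)))
        := s :* (s :* (s :* (s :* con 1ℚ))) :- u :* u :* (# 12 :* A :* (s :* s)) :+ u :* u :* u :* (# 48 :* B :* s)
          :+ u :* u :* u :* u :* (# 6 :* (A :* A :- # 12 :* C))) refl
      dehomogenise : ∀ A B C s →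
        s * (s * (s * (s * 1ℚ))) - 1ℚ * 1ℚ * (num 12 * A * (s * s)) + 1ℚ * 1ℚ * 1ℚ * (num 48 * B * s)
          + 1ℚ * 1ℚ * 1ℚ * 1ℚ * (num 6 * (A * A - num 12 * C))
        ≡ s * (s * (s * (s * 1ℚ))) - num 12 * A * (s * (s * 1ℚ)) + num 48 * B * s
          + num 6 * (A * (A * 1ℚ) - num 12 * C)
      dehomogenise = solve 4 (λ A B C s → let i = con 1ℚ in
        s :* (s :* (s :* (s :* i))) :- i :* i :* (# 12 :* A :* (s :* s)) :+ i :* i :* i :* (# 48 :* B :* s)
          :+ i :* i :* i :* i :* (# 6 :* (A :* A :- # 12 :* C))
        := s :* (s :* (s :* (s :* i))) :- # 12 :* A :* (s :* (s :* i)) :+ # 48 :* B :* s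
          :+ # 6 :* (A :* (A :* i) :- # 12 :* C)) refl

    -- Cross-multiplying s = m / 2n gives m · ↧s = ↥s · 2n. The right side is divisible by 2^j, and
    -- the odd factor `m` can be removed.
    2^j∣denominator : 2^ j ∣ ↧ s-coordinate
    2^j∣denominator = 2^j∣odd*i⇒2^j∣i j m (↧ s) m-odd
      (subst (2^ j ∣_) (sym cross) (∣n⇒∣m*n (↥ s) (∣n⇒∣m*n (+ 2) 2^j∣n)))
      where
      open ≡-Reasoning
      s = s-coordinate
      cross : m ℤ.* ↧ s ≡ ↥ s ℤ.* (+ 2 ℤ.* n)
      cross = fromℤ-injective _ _ (begin
        fromℤ (m ℤ.* ↧ s)                       ≡⟨ fromℤ-* m (↧ s) ⟩
        M * fromℤ (↧ s)                         ≡⟨ ℚₚ.*-identityʳ _ ⟨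
        M * fromℤ (↧ s) * 1ℚ                    ≡⟨ cong (M * fromℤ (↧ s) *_) 2Nw≡1 ⟨
        M * fromℤ (↧ s) * (num 2 * N * w)       ≡⟨ solve 4 (λ M d x w → M :* d :* (x :* w) := d :* (M :* w) :* x)
                                                     refl M (fromℤ (↧ s)) (num 2 * N) w ⟩
        fromℤ (↧ s) * s * (num 2 * N)           ≡⟨ cong (_* (num 2 * N)) (↧q*q≡↥q s) ⟩
        fromℤ (↥ s) * (num 2 * N)               ≡⟨ image (⟨ ↥ s ⟩ ⊗ (⟨ + 2 ⟩ ⊗ ⟨ n ⟩)) ⟨
        fromℤ (↥ s ℤ.* (+ 2 ℤ.* n))             ∎)

  n≤2^n : ∀ n → n ℕ.≤ 2 ℕ.^ n
  n≤2^n zero    = z≤n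
  n≤2^n (suc n) = ℕₚ.+-mono-≤ (ℕₚ.m^n>0 2 n) (ℕₚ.≤-trans (n≤2^n n) (ℕₚ.m≤m+n _ 0))

  infinitely-many-points : ∀ a b c → b ≢ 0ℤ → + 2 ∣ a ℤ.- 1ℤ → Infinite ℚ²-setoid (OnC a b c)
  infinitely-many-points a b c b≢0 a-odd =
    infinite-if-unbounded ℚ²-setoid (OnC a b c) (λ (s , _) → ↧ₙ s) λ j →
      let point = dyadicPoint {a} {b} {c} b≢0 a-odd j in
      (s-coordinate point , v-coordinate point) , point-onC point , λ (s , _) (s≡ , _) →
        ℕₚ.≤-trans (n≤2^n j) (subst (λ x → 2 ℕ.^ j ℕ.≤ ↧ₙ x) s≡ (ℕ∣.∣⇒≤ (∣⇒∣ᵤ (2^j∣denominator point))))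

-- Polynomials as functions: evaluation, composition and the identity principle.

module Evaluation where

  open import Data.Rational.Base using (_+_; _*_; _-_; -_)
  open +-*-Solver
  open Rationals

  ev : ℚ[t] → ℚ → ℚ
  ev []      τ = 0ℚ
  ev (q ∷ p) τ = q + τ * ev p τ

  ev-const : ∀ q τ → ev (const q) τ ≡ q
  ev-const = solve 2 (λ q τ → q :+ τ :* con 0ℚ := q) refl

  ev-t : ∀ τ → ev t τ ≡ τ
  ev-t = solve 1 (λ τ → con 0ℚ :+ τ :* (con 1ℚ :+ τ :* con 0ℚ) := τ) refl

  ev-+ : ∀ p r τ → ev (p P.+ r) τ ≡ ev p τ + ev r τ
  ev-+ []      r       τ = sym (ℚₚ.+-identityˡ _)
  ev-+ (q ∷ p) []      τ = sym (ℚₚ.+-identityʳ _)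
  ev-+ (q ∷ p) (s ∷ r) τ = trans (cong (λ x → q + s + τ * x) (ev-+ p r τ))
    (solve 5 (λ q s τ x y → q :+ s :+ τ :* (x :+ y) := q :+ τ :* x :+ (s :+ τ :* y)) refl
      q s τ (ev p τ) (ev r τ))

  ev-scale : ∀ q p τ → ev (map (λ s → q * s) p) τ ≡ q * ev p τ
  ev-scale q []      τ = sym (ℚₚ.*-zeroʳ q)
  ev-scale q (s ∷ p) τ = trans (cong (λ x → q * s + τ * x) (ev-scale q p τ))
    (solve 4 (λ q s τ x → q :* s :+ τ :* (q :* x) := q :* (s :+ τ :* x)) refl q s τ (ev p τ))

  ev-neg : ∀ p τ → ev (P.- p) τ ≡ - ev p τ
  ev-neg []      τ = refl
  ev-neg (q ∷ p) τ = trans (cong (λ x → - q + τ * x) (ev-neg p τ))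
    (solve 3 (λ q τ x → :- q :+ τ :* (:- x) := :- (q :+ τ :* x)) refl q τ (ev p τ))

  ev-- : ∀ p r τ → ev (p P.- r) τ ≡ ev p τ - ev r τ
  ev-- p r τ = trans (ev-+ p (P.- r) τ) (cong (_+_ (ev p τ)) (ev-neg r τ))

  ev-* : ∀ p r τ → ev (p P.* r) τ ≡ ev p τ * ev r τ
  ev-* []      r τ = sym (ℚₚ.*-zeroˡ (ev r τ))
  ev-* (q ∷ p) r τ = begin
    ev (map (λ s → q * s) r P.+ (0ℚ ∷ (p P.* r))) τ     ≡⟨ ev-+ (map (λ s → q * s) r) (0ℚ ∷ (p P.* r)) τ ⟩
    ev (map (λ s → q * s) r) τ + (0ℚ + τ * ev (p P.* r) τ)
      ≡⟨ cong₂ (λ x y → x + (0ℚ + τ * y)) (ev-scale q r τ) (ev-* p r τ) ⟩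
    q * ev r τ + (0ℚ + τ * (ev p τ * ev r τ))
      ≡⟨ solve 4 (λ q τ x y → q :* y :+ (con 0ℚ :+ τ :* (x :* y)) := (q :+ τ :* x) :* y) refl q τ (ev p τ) (ev r τ) ⟩
    (q + τ * ev p τ) * ev r τ                           ∎
    where open ≡-Reasoning

  ev-^ : ∀ p n τ → ev (p ^ n) τ ≡ ev p τ ^ℚ n
  ev-^ p zero    τ = ev-const 1ℚ τ
  ev-^ p (suc n) τ = trans (ev-* p (p ^ n) τ) (cong (_*_ (ev p τ)) (ev-^ p n τ))

  infixr 9 _∘ₚ_
  _∘ₚ_ : ℚ[t] → ℚ[t] → ℚ[t]
  []      ∘ₚ z = []
  (q ∷ p) ∘ₚ z = const q P.+ z P.* (p ∘ₚ z)

  ev-∘ₚ : ∀ p z τ → ev (p ∘ₚ z) τ ≡ ev p (ev z τ)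
  ev-∘ₚ []      z τ = refl
  ev-∘ₚ (q ∷ p) z τ = trans (ev-+ (const q) (z P.* (p ∘ₚ z)) τ)
    (cong₂ _+_ (ev-const q τ) (trans (ev-* z (p ∘ₚ z) τ) (cong (_*_ (ev z τ)) (ev-∘ₚ p z τ))))

  coeff-- : ∀ p r i → coeff (p P.- r) i ≡ coeff p i - coeff r i
  coeff-- p r i = trans (coeff-+ p (P.- r) i) (cong (_+_ (coeff p i)) (coeff-neg r i))
    where
    coeff-+ : ∀ p r i → coeff (p P.+ r) i ≡ coeff p i + coeff r i
    coeff-+ []      r       i       = sym (ℚₚ.+-identityˡ _)
    coeff-+ (q ∷ p) []      i       = sym (ℚₚ.+-identityʳ _)
    coeff-+ (q ∷ p) (s ∷ r) zero    = refl
    coeff-+ (q ∷ p) (s ∷ r) (suc i) = coeff-+ p r i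
    coeff-neg : ∀ p i → coeff (P.- p) i ≡ - coeff p i
    coeff-neg []      i       = refl
    coeff-neg (q ∷ p) zero    = refl
    coeff-neg (q ∷ p) (suc i) = coeff-neg p i

  ev-zero : ∀ p τ → (∀ i → coeff p i ≡ 0ℚ) → ev p τ ≡ 0ℚ
  ev-zero []      τ p≡0 = refl
  ev-zero (q ∷ p) τ p≡0 = trans (cong₂ (λ x y → x + τ * y) (p≡0 0) (ev-zero p τ (λ i → p≡0 (suc i))))
    (solve 1 (λ τ → con 0ℚ :+ τ :* con 0ℚ := con 0ℚ) refl τ)

  -- The two lists may differ in length by trailing zeros; passing to the difference leaves a single
  -- list of zeros.
  ev-cong : ∀ p r τ → p ≈ r → ev p τ ≡ ev r τ
  ev-cong p r τ p≈r = p-q≡0⇒p≡q _ _ (trans (sym (ev-- p r τ)) (ev-zero (p P.- r) τ λ i →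
    trans (coeff-- p r i) (trans (cong (_- coeff r i) (coeff-≡ p≈r i)) (ℚₚ.+-inverseʳ (coeff r i)))))

  -- Synthetic division: quotient ρ p is the quotient of q + t p by t - ρ, for every constant q.
  quotient : ℚ → ℚ[t] → ℚ[t]
  quotient ρ []      = []
  quotient ρ (q ∷ p) = ev (q ∷ p) ρ ∷ quotient ρ p

  ev-quotient : ∀ q p ρ τ → ev (q ∷ p) τ - ev (q ∷ p) ρ ≡ (τ - ρ) * ev (quotient ρ p) τ
  ev-quotient q []       ρ τ = solve 3 (λ q ρ τ →
    q :+ τ :* con 0ℚ :- (q :+ ρ :* con 0ℚ) := (τ :- ρ) :* con 0ℚ) refl q ρ τ
  ev-quotient q (q′ ∷ p) ρ τ = begin
    q + τ * ev (q′ ∷ p) τ - (q + ρ * ev (q′ ∷ p) ρ)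
      ≡⟨ solve 5 (λ q τ ρ x y → q :+ τ :* x :- (q :+ ρ :* y) := τ :* (x :- y) :+ (τ :- ρ) :* y)
           refl q τ ρ (ev (q′ ∷ p) τ) (ev (q′ ∷ p) ρ) ⟩
    τ * (ev (q′ ∷ p) τ - ev (q′ ∷ p) ρ) + (τ - ρ) * ev (q′ ∷ p) ρ
      ≡⟨ cong (λ x → τ * x + (τ - ρ) * ev (q′ ∷ p) ρ) (ev-quotient q′ p ρ τ) ⟩
    τ * ((τ - ρ) * ev (quotient ρ p) τ) + (τ - ρ) * ev (q′ ∷ p) ρ
      ≡⟨ solve 4 (λ τ ρ x y → τ :* ((τ :- ρ) :* x) :+ (τ :- ρ) :* y := (τ :- ρ) :* (y :+ τ :* x))
           refl τ ρ (ev (quotient ρ p) τ) (ev (q′ ∷ p) ρ) ⟩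
    (τ - ρ) * (ev (q′ ∷ p) ρ + τ * ev (quotient ρ p) τ) ∎
    where open ≡-Reasoning

  private
    head-zero : ∀ q ρ x → q + ρ * x ≡ 0ℚ → x ≡ 0ℚ → q ≡ 0ℚ
    head-zero q ρ x eq refl = trans (solve 2 (λ q ρ → q := q :+ ρ :* con 0ℚ) refl q ρ) eq

    coeff-quotient-zero : ∀ ρ p → coeff (quotient ρ p) 0 ≡ ev p ρ
    coeff-quotient-zero ρ []      = refl
    coeff-quotient-zero ρ (q ∷ p) = refl

  -- The quotient lists the values at `ρ` of the successive tails of `p`, and each coefficient q =
  -- ev (q ∷ p) ρ - ρ · ev p ρ is determined by two neighbouring values.
  quotient-zero : ∀ ρ p → (∀ i → coeff (quotient ρ p) i ≡ 0ℚ) → ∀ i → coeff p i ≡ 0ℚ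
  quotient-zero ρ []      eq i       = refl
  quotient-zero ρ (q ∷ p) eq zero    =
    head-zero q ρ (ev p ρ) (eq 0) (trans (sym (coeff-quotient-zero ρ p)) (eq 1))
  quotient-zero ρ (q ∷ p) eq (suc i) = quotient-zero ρ p (λ i → eq (suc i)) i

  length-quotient : ∀ ρ p → length (quotient ρ p) ≡ length p
  length-quotient ρ []      = refl
  length-quotient ρ (q ∷ p) = cong suc (length-quotient ρ p)

  -- Divide out the root N: for n > N the factor n - N is nonzero, so the quotient vanishes from N +
  -- 1 on and is zero by induction. The recursion runs on the length `l` because the quotient is not
  -- a sublist of `p`.
  vanishing : ∀ l p N → length p ≡ l → (∀ n → N ℕ.≤ n → ev p (num n) ≡ 0ℚ) → ∀ i → coeff p i ≡ 0ℚ
  vanishing zero    []      N _   _    i = refl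
  vanishing (suc l) (q ∷ p) N len root = λ where
      zero    → head-zero q ρ (ev p ρ) (root N ℕₚ.≤-refl)
                  (trans (sym (coeff-quotient-zero ρ p)) (quotient≡0 0))
      (suc i) → quotient-zero ρ p quotient≡0 i
    where
    ρ = num N
    quotient≡0 : ∀ i → coeff (quotient ρ p) i ≡ 0ℚ
    quotient≡0 = vanishing l (quotient ρ p) (suc N)
      (trans (length-quotient ρ p) (ℕₚ.suc-injective len)) λ n N<n →
      *-zero-cancel (num n - ρ) (ev (quotient ρ p) (num n))
        (λ eq → ℕₚ.<⇒≢ N<n (sym (num-injective n N (p-q≡0⇒p≡q (num n) ρ eq))))
        (trans (sym (ev-quotient q p ρ (num n)))
          (cong₂ _-_ (root n (ℕₚ.<⇒≤ N<n)) (root N ℕₚ.≤-refl)))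

  -- This reduces identities in ℚ[t] to identities between rational values, which the ring solver
  -- can treat.
  ≈-if-ev : ∀ p r → (∀ τ → ev p τ ≡ ev r τ) → p ≈ r
  ≈-if-ev p r eq = mk≈ λ i → p-q≡0⇒p≡q _ _ (trans (sym (coeff-- p r i))
    (vanishing _ (p P.- r) 0 refl (λ n _ → trans (ev-- p r (num n))
      (trans (cong (_- ev r (num n)) (eq (num n))) (ℚₚ.+-inverseʳ (ev r (num n))))) i))

-- From a linear remainder to a solution, and a size that separates solutions.

module Solutions where

  open import Data.Rational.Base using (_+_; _*_; _-_; -_)
  open +-*-Solver
  open Rationals
  open Evaluation

  gℚ : (A B C D E ζ : ℚ) → ℚ
  gℚ A B C D E ζ = ζ ^ℚ 6 + A * ζ ^ℚ 4 + B * ζ ^ℚ 3 + C * ζ ^ℚ 2 + D * ζ + E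

  ev-g : ∀ a b c d e z τ →
    ev (g a b c d e z) τ ≡ gℚ (fromℤ a) (fromℤ b) (fromℤ c) (fromℤ d) (fromℤ e) (ev z τ)
  ev-g a b c d e z τ =
    trans (ev-+ (z ^ 6 P.+ z₄ P.+ z₃ P.+ z₂ P.+ z₁) (const (fromℤ e)) τ) (cong₂ _+_
      (trans (ev-+ (z ^ 6 P.+ z₄ P.+ z₃ P.+ z₂) z₁ τ) (cong₂ _+_
        (trans (ev-+ (z ^ 6 P.+ z₄ P.+ z₃) z₂ τ) (cong₂ _+_
          (trans (ev-+ (z ^ 6 P.+ z₄) z₃ τ) (cong₂ _+_
            (trans (ev-+ (z ^ 6) z₄ τ) (cong₂ _+_ (ev-^ z 6 τ) (monomial a 4)))
            (monomial b 3)))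
          (monomial c 2)))
        (trans (ev-* (const (fromℤ d)) z τ) (cong (_* ev z τ) (ev-const (fromℤ d) τ)))))
      (ev-const (fromℤ e) τ))
    where
    z₁ z₂ z₃ z₄ : ℚ[t]
    z₁ = const (fromℤ d) P.* z
    z₂ = const (fromℤ c) P.* z ^ 2
    z₃ = const (fromℤ b) P.* z ^ 3
    z₄ = const (fromℤ a) P.* z ^ 4
    monomial : ∀ i n → ev (const (fromℤ i) P.* z ^ n) τ ≡ fromℤ i * ev z τ ^ℚ n
    monomial i n = trans (ev-* (const (fromℤ i)) (z ^ n) τ) (cong₂ _*_ (ev-const (fromℤ i) τ) (ev-^ z n τ))

  -- n and large bound the size of the resulting solution from below by N.
  record LinearRemainder (A B C D E : ℚ) (N : ℕ) : Set where
    field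
      X Y      : ℚ[t]
      ℓ f      : ℚ
      ℓ≢0      : ℓ ≢ 0ℚ
      identity : ∀ ζ → ev X ζ ^ℚ 2 - ev Y ζ ^ℚ 3 - gℚ A B C D E ζ ≡ ℓ * ζ + f
      n        : ℕ
      N≤n      : N ℕ.≤ n
      large    : ev Y 0ℚ ≡ num n ⊎ ev Y 1ℚ - ev Y 0ℚ ≡ num n

    z : ℚ[t]
    z = - (f * inv ℓ) ∷ inv ℓ ∷ []

    solution : ℚ[t] × ℚ[t] × ℚ[t]
    solution = X ∘ₚ z , Y ∘ₚ z , z

    ℓz+f≡t : ∀ τ → ℓ * ev z τ + f ≡ τ
    ℓz+f≡t τ = begin
      ℓ * (- (f * inv ℓ) + τ * (inv ℓ + τ * 0ℚ)) + f
        ≡⟨ solve 4 (λ ℓ i f τ → ℓ :* (:- (f :* i) :+ τ :* (i :+ τ :* con 0ℚ)) :+ f := ℓ :* i :* (τ :- f) :+ f)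
             refl ℓ (inv ℓ) f τ ⟩
      ℓ * inv ℓ * (τ - f) + f    ≡⟨ cong (λ u → u * (τ - f) + f) (*-inv ℓ ℓ≢0) ⟩
      1ℚ * (τ - f) + f           ≡⟨ solve 2 (λ τ f → con 1ℚ :* (τ :- f) :+ f := τ) refl τ f ⟩
      τ                          ∎
      where open ≡-Reasoning

  -- The value at ζ of the polynomial Y with y = Y ∘ z, for z of degree one.
  valueAt : ℚ → ℚ[t] × ℚ[t] × ℚ[t] → ℚ
  valueAt ζ (x , y , z) = ev y ((ζ - ev z 0ℚ) * inv (ev z 1ℚ - ev z 0ℚ))

  -- The sum dominates `n` under either alternative of `large`.
  size : ℚ[t] × ℚ[t] × ℚ[t] → ℕ
  size S = ℤ.∣ ↥ valueAt 0ℚ S ∣ ℕ.+ ℤ.∣ ↥ (valueAt 1ℚ S - valueAt 0ℚ S) ∣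

  valueAt-cong : ∀ ζ S S′ → Setoid._≈_ ℚ[t]³-setoid S S′ → valueAt ζ S ≡ valueAt ζ S′
  valueAt-cong ζ (x , y , z) (x′ , y′ , z′) (_ , y≈y′ , z≈z′) = trans
    (ev-cong y y′ _ y≈y′)
    (cong₂ (λ u v → ev y′ ((ζ - u) * inv (v - u))) (ev-cong z z′ 0ℚ z≈z′) (ev-cong z z′ 1ℚ z≈z′))

  module _ {A B C D E N} (L : LinearRemainder A B C D E N) where

    open LinearRemainder L

    -- As `z` is affine with slope 1/ℓ ≠ 0, the point at which `valueAt` evaluates y is the preimage
    -- of `ζ` under `z`.
    valueAt-solution : ∀ ζ → valueAt ζ solution ≡ ev Y ζ
    valueAt-solution ζ = trans (ev-∘ₚ Y z τ) (cong (ev Y) (begin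
      z₀ + τ * (ι + τ * 0ℚ)
        ≡⟨ solve 4 (λ z₀ ι ζ k → z₀ :+ (ζ :- (z₀ :+ con 0ℚ :* (ι :+ con 0ℚ :* con 0ℚ))) :* k :* (ι :+ (ζ :- (z₀ :+ con 0ℚ :* (ι :+ con 0ℚ :* con 0ℚ))) :* k :* con 0ℚ)
             := z₀ :+ (ζ :- z₀) :* (ι :* k)) refl z₀ ι ζ (inv slope) ⟩
      z₀ + (ζ - z₀) * (ι * inv slope)
        ≡⟨ cong (λ u → z₀ + (ζ - z₀) * (ι * inv u)) slope≡ι ⟩
      z₀ + (ζ - z₀) * (ι * inv ι)
        ≡⟨ cong (λ u → z₀ + (ζ - z₀) * u) (*-inv ι (inv-≢0 ℓ ℓ≢0)) ⟩
      z₀ + (ζ - z₀) * 1ℚ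
        ≡⟨ solve 2 (λ z₀ ζ → z₀ :+ (ζ :- z₀) :* con 1ℚ := ζ) refl z₀ ζ ⟩
      ζ ∎))
      where
      open ≡-Reasoning
      ι z₀ slope τ : ℚ
      ι     = inv ℓ
      z₀    = - (f * ι)
      slope = ev z 1ℚ - ev z 0ℚ
      τ     = (ζ - ev z 0ℚ) * inv slope
      slope≡ι : slope ≡ ι
      slope≡ι = solve 2 (λ z₀ ι → z₀ :+ con 1ℚ :* (ι :+ con 1ℚ :* con 0ℚ) :- (z₀ :+ con 0ℚ :* (ι :+ con 0ℚ :* con 0ℚ)) := ι)
        refl z₀ ι

    N≤size : ∀ S → Setoid._≈_ ℚ[t]³-setoid solution S → N ℕ.≤ size S
    N≤size S sol≈S = ℕₚ.≤-trans N≤n (bound large)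
      where
      value : ∀ ζ → valueAt ζ S ≡ ev Y ζ
      value ζ = trans (sym (valueAt-cong ζ solution S sol≈S)) (valueAt-solution ζ)
      bound : ev Y 0ℚ ≡ num n ⊎ ev Y 1ℚ - ev Y 0ℚ ≡ num n → n ℕ.≤ size S
      bound (inj₁ eq) = ℕₚ.≤-trans
        (subst (λ q → n ℕ.≤ ℤ.∣ ↥ q ∣) (sym (trans (value 0ℚ) eq)) (n≤∣↥num∣ n))
        (ℕₚ.m≤m+n _ _)
      bound (inj₂ eq) = ℕₚ.≤-trans
        (subst (λ q → n ℕ.≤ ℤ.∣ ↥ q ∣) (sym (trans (cong₂ _-_ (value 1ℚ) (value 0ℚ)) eq)) (n≤∣↥num∣ n))
        (ℕₚ.m≤n+m _ _)

  isSolution : ∀ a b c d e {N} (L : LinearRemainder (fromℤ a) (fromℤ b) (fromℤ c) (fromℤ d) (fromℤ e) N) →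
    IsSolution a b c d e (LinearRemainder.solution L)
  isSolution a b c d e L = ≈-if-ev (x ^ 2 P.- y ^ 3 P.- g a b c d e z) t λ τ → begin
    ev (x ^ 2 P.- y ^ 3 P.- g a b c d e z) τ
      ≡⟨ ev-- (x ^ 2 P.- y ^ 3) (g a b c d e z) τ ⟩
    ev (x ^ 2 P.- y ^ 3) τ - ev (g a b c d e z) τ
      ≡⟨ cong₂ _-_ (ev-- (x ^ 2) (y ^ 3) τ) (ev-g a b c d e z τ) ⟩
    ev (x ^ 2) τ - ev (y ^ 3) τ - G (ev z τ)
      ≡⟨ cong₂ (λ u v → u - v - G (ev z τ)) (ev-^ x 2 τ) (ev-^ y 3 τ) ⟩
    ev x τ ^ℚ 2 - ev y τ ^ℚ 3 - G (ev z τ)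
      ≡⟨ cong₂ (λ u v → u ^ℚ 2 - v ^ℚ 3 - G (ev z τ)) (ev-∘ₚ X z τ) (ev-∘ₚ Y z τ) ⟩
    ev X (ev z τ) ^ℚ 2 - ev Y (ev z τ) ^ℚ 3 - G (ev z τ)
      ≡⟨ identity (ev z τ) ⟩
    ℓ * ev z τ + f    ≡⟨ ℓz+f≡t τ ⟩
    τ                 ≡⟨ ev-t τ ⟨
    ev t τ            ∎
    where
    open ≡-Reasoning
    open LinearRemainder L
    x = X ∘ₚ z
    y = Y ∘ₚ z
    G = gℚ (fromℤ a) (fromℤ b) (fromℤ c) (fromℤ d) (fromℤ e)

  infinitely-many : ∀ a b c d e →
    (∀ N → LinearRemainder (fromℤ a) (fromℤ b) (fromℤ c) (fromℤ d) (fromℤ e) N) →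
    Infinite ℚ[t]³-setoid (IsSolution a b c d e)
  infinitely-many a b c d e L = infinite-if-unbounded ℚ[t]³-setoid (IsSolution a b c d e) size λ N →
    LinearRemainder.solution (L N) , isSolution a b c d e (L N) , N≤size (L N)

-- The three families of linear remainders.

module Families where

  open import Data.Rational.Base using (_+_; _*_; _-_; -_)
  open +-*-Solver
  open Rationals
  open Evaluation
  open Solutions

  ⅓ : ℚ
  ⅓ = + 1 ℚ./ 3

  private
    -- Solver syntax for `gℚ`, and below for `ev` and the left side of `identity`; powers are
    -- written as `_^ℚ_` unfolds, so that the solved equations match definitionally.
    :g : ∀ {n} (A B C D E ζ : Polynomial n) → Polynomial n
    :g A B C D E ζ = ζ :* (ζ :* (ζ :* (ζ :* (ζ :* (ζ :* con 1ℚ))))) :+ A :* (ζ :* (ζ :* (ζ :* (ζ :* con 1ℚ))))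
      :+ B :* (ζ :* (ζ :* (ζ :* con 1ℚ))) :+ C :* (ζ :* (ζ :* con 1ℚ)) :+ D :* ζ :+ E

    :ev : ∀ {n} → List (Polynomial n) → Polynomial n → Polynomial n
    :ev []      ζ = con 0ℚ
    :ev (q ∷ p) ζ = q :+ ζ :* :ev p ζ

    :lhs : ∀ {n} (X Y : List (Polynomial n)) (A B C D E ζ : Polynomial n) → Polynomial n
    :lhs X Y A B C D E ζ = :ev X ζ :* (:ev X ζ :* con 1ℚ) :- :ev Y ζ :* (:ev Y ζ :* (:ev Y ζ :* con 1ℚ))
      :- :g A B C D E ζ

  -- Divided differences: subtracting two equations and cancelling u - v lowers the degree, and
  -- doing so twice isolates `α`.
  quadratic-zero : ∀ α β γ u₁ u₂ u₃ → u₁ ≢ u₂ → u₁ ≢ u₃ → u₂ ≢ u₃ →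
    α * (u₁ * u₁) + β * u₁ + γ ≡ 0ℚ → α * (u₂ * u₂) + β * u₂ + γ ≡ 0ℚ →
    α * (u₃ * u₃) + β * u₃ + γ ≡ 0ℚ → α ≡ 0ℚ × β ≡ 0ℚ × γ ≡ 0ℚ
  quadratic-zero α β γ u₁ u₂ u₃ u₁≢u₂ u₁≢u₃ u₂≢u₃ root₁ root₂ root₃ = α≡0 , β≡0 , γ≡0
    where
    difference : ∀ u v → u ≢ v → α * (u * u) + β * u + γ ≡ 0ℚ → α * (v * v) + β * v + γ ≡ 0ℚ →
      α * (u + v) + β ≡ 0ℚ
    difference u v u≢v root root′ = *-zero-cancel (u - v) _ (λ eq → u≢v (p-q≡0⇒p≡q u v eq))
      (trans (solve 5 (λ α β γ u v → (u :- v) :* (α :* (u :+ v) :+ β)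
          := α :* (u :* u) :+ β :* u :+ γ :- (α :* (v :* v) :+ β :* v :+ γ)) refl α β γ u v)
        (cong₂ _-_ root root′))
    α≡0 : α ≡ 0ℚ
    α≡0 = *-zero-cancel (u₂ - u₃) α (λ eq → u₂≢u₃ (p-q≡0⇒p≡q u₂ u₃ eq))
      (trans (solve 5 (λ α β u v w → (v :- w) :* α := α :* (u :+ v) :+ β :- (α :* (u :+ w) :+ β)) refl α β u₁ u₂ u₃)
        (cong₂ _-_ (difference u₁ u₂ u₁≢u₂ root₁ root₂) (difference u₁ u₃ u₁≢u₃ root₁ root₃)))
    β≡0 : β ≡ 0ℚ
    β≡0 = trans (solve 2 (λ β s → β := con 0ℚ :* s :+ β) refl β (u₁ + u₂))
      (subst (λ α → α * (u₁ + u₂) + β ≡ 0ℚ) α≡0 (difference u₁ u₂ u₁≢u₂ root₁ root₂))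
    γ≡0 : γ ≡ 0ℚ
    γ≡0 = trans (solve 2 (λ γ u → γ := con 0ℚ :* (u :* u) :+ con 0ℚ :* u :+ γ) refl γ u₁)
      (subst₂ (λ α β → α * (u₁ * u₁) + β * u₁ + γ ≡ 0ℚ) α≡0 β≡0 root₁)

  module Line (A B C D E : ℚ) (s : ℚ) where

    σ p q w ℓ f : ℚ
    σ = inv s
    -- Matching Z⁴, Z³ and Z² gives 2p = A, 2q - s³ = B and p² - 3s²w = C.
    p = ½ * A
    q = ½ * (B + s * s * s)
    w = ⅓ * (p * p - C) * (σ * σ)
    ℓ = num 2 * p * q - num 3 * s * w * w - D
    f = q * q - w * w * w - E

    module _ (s≢0 : s ≢ 0ℚ) where

      identity : ∀ ζ → ev (q ∷ p ∷ 0ℚ ∷ 1ℚ ∷ []) ζ ^ℚ 2 - ev (w ∷ s ∷ []) ζ ^ℚ 3 - gℚ A B C D E ζ ≡ ℓ * ζ + f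
      identity ζ = begin
        x * (x * 1ℚ) - y * (y * (y * 1ℚ)) - gℚ A B C D E ζ
          -- The solver treats `σ` as independent of `s`; the resulting error in Z² carries the
          -- factor 1 - (sσ)².
          ≡⟨ expand A B C D E s σ ζ ⟩
        (1ℚ - s * σ * (s * σ)) * (½ * A * (½ * A) - C) * (ζ * ζ) + (ℓ * ζ + f)
          ≡⟨ cong (λ u → (1ℚ - u * u) * (½ * A * (½ * A) - C) * (ζ * ζ) + (ℓ * ζ + f)) (*-inv s s≢0) ⟩
        (1ℚ - 1ℚ * 1ℚ) * (½ * A * (½ * A) - C) * (ζ * ζ) + (ℓ * ζ + f)
          ≡⟨ solve 3 (λ u v r → (con 1ℚ :- con 1ℚ :* con 1ℚ) :* u :* v :+ r := r) refl (½ * A * (½ * A) - C) (ζ * ζ) (ℓ * ζ + f) ⟩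
        ℓ * ζ + f ∎
        where
        open ≡-Reasoning
        x y : ℚ
        x = ev (q ∷ p ∷ 0ℚ ∷ 1ℚ ∷ []) ζ
        y = ev (w ∷ s ∷ []) ζ
        expand : ∀ A B C D E s σ ζ →
          let p = ½ * A
              q = ½ * (B + s * s * s)
              w = ⅓ * (p * p - C) * (σ * σ)
          in ev (q ∷ p ∷ 0ℚ ∷ 1ℚ ∷ []) ζ ^ℚ 2 - ev (w ∷ s ∷ []) ζ ^ℚ 3 - gℚ A B C D E ζ
             ≡ (1ℚ - s * σ * (s * σ)) * (½ * A * (½ * A) - C) * (ζ * ζ)
               + ((num 2 * p * q - num 3 * s * w * w - D) * ζ + (q * q - w * w * w - E))
        expand = solve 8 (λ A B C D E s σ ζ →
          let p = con ½ :* A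
              q = con ½ :* (B :+ s :* s :* s)
              w = con ⅓ :* (p :* p :- C) :* (σ :* σ)
          in :lhs (q ∷ p ∷ con 0ℚ ∷ con 1ℚ ∷ []) (w ∷ s ∷ []) A B C D E ζ
             := (con 1ℚ :- s :* σ :* (s :* σ)) :* (con ½ :* A :* (con ½ :* A) :- C) :* (ζ :* ζ)
               :+ ((# 2 :* p :* q :- # 3 :* s :* w :* w :- D) :* ζ :+ (q :* q :- w :* w :* w :- E))) refl

      -- Since 3sw² = (p² - C)² / 3s³, multiplying `ℓ` by s³ clears denominators and leaves a
      -- quadratic in s³ whose coefficients do not involve `s`.
      quadratic : ℓ ≡ 0ℚ → let u = s * s * s in
        p * (u * u) + (p * B - D) * u + - (⅓ * ((p * p - C) * (p * p - C))) ≡ 0ℚ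
      quadratic ℓ≡0 = begin
        p * (u * u) + (p * B - D) * u + - (⅓ * (k * k))
          ≡⟨ expand p B D k s σ ⟩
        (num 2 * p * q - num 3 * s * w * w - D) * u + (s * σ * (s * σ) * (s * σ * (s * σ)) - 1ℚ) * (⅓ * (k * k))
          ≡⟨ cong₂ (λ l v → l * u + (v * v * (v * v) - 1ℚ) * (⅓ * (k * k))) ℓ≡0 (*-inv s s≢0) ⟩
        0ℚ * u + (1ℚ * 1ℚ * (1ℚ * 1ℚ) - 1ℚ) * (⅓ * (k * k))
          ≡⟨ solve 2 (λ u v → con 0ℚ :* u :+ (con 1ℚ :* con 1ℚ :* (con 1ℚ :* con 1ℚ) :- con 1ℚ) :* v := con 0ℚ) refl u (⅓ * (k * k)) ⟩
        0ℚ ∎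
        where
        open ≡-Reasoning
        u k : ℚ
        u = s * s * s
        k = p * p - C
        expand : ∀ p B D k s σ →
          let u = s * s * s
              q = ½ * (B + s * s * s)
              w = ⅓ * k * (σ * σ)
          in p * (u * u) + (p * B - D) * u + - (⅓ * (k * k))
             ≡ (num 2 * p * q - num 3 * s * w * w - D) * u + (s * σ * (s * σ) * (s * σ * (s * σ)) - 1ℚ) * (⅓ * (k * k))
        expand = solve 6 (λ p B D k s σ →
          let u = s :* s :* s
              q = con ½ :* (B :+ s :* s :* s)
              w = con ⅓ :* k :* (σ :* σ)
          in p :* (u :* u) :+ (p :* B :- D) :* u :+ :- (con ⅓ :* (k :* k))
             := (# 2 :* p :* q :- # 3 :* s :* w :* w :- D) :* u
               :+ (s :* σ :* (s :* σ) :* (s :* σ :* (s :* σ)) :- con 1ℚ) :* (con ⅓ :* (k :* k))) refl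

  -- One of s = N+1, N+2, N+3 has ℓ ≠ 0: otherwise the quadratic has three distinct roots s³, and
  -- its vanishing coefficients force A = C = D = 0. The size is controlled by Y(1) - Y(0) = s.
  lineFamily : ∀ A B C D E → ¬ (A ≡ 0ℚ × C ≡ 0ℚ × D ≡ 0ℚ) → ∀ N → LinearRemainder A B C D E N
  lineFamily A B C D E nontrivial N = choose (ℓ 1 ℚₚ.≟ 0ℚ) (ℓ 2 ℚₚ.≟ 0ℚ) (ℓ 3 ℚₚ.≟ 0ℚ)
    where
    parameter : ℕ → ℚ
    parameter i = num (i ℕ.+ N)
    ℓ : ℕ → ℚ
    ℓ i = Line.ℓ A B C D E (parameter i)

    parameter≢0 : ∀ i → parameter (suc i) ≢ 0ℚ
    parameter≢0 i eq with num-injective (suc i ℕ.+ N) 0 eq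
    ... | ()

    cube : ℕ → ℚ
    cube i = parameter i * parameter i * parameter i

    cube-≢ : ∀ i j → i ℕ.< j → cube i ≢ cube j
    cube-≢ i j i<j eq = ℕₚ.<⇒≢ (ℕₚ.*-mono-< (ℕₚ.*-mono-< i+N<j+N i+N<j+N) i+N<j+N)
      (num-injective _ _ (trans (num-cube (i ℕ.+ N)) (trans eq (sym (num-cube (j ℕ.+ N))))))
      where
      i+N<j+N = ℕₚ.+-monoˡ-< N i<j
      num-cube : ∀ k → num (k ℕ.* k ℕ.* k) ≡ num k * num k * num k
      num-cube k = trans (num-* (k ℕ.* k) k) (cong (_* num k) (num-* k k))

    family : ∀ i → ℓ (suc i) ≢ 0ℚ → LinearRemainder A B C D E N
    family i ℓ≢0 = record
      { X        = q ∷ p ∷ 0ℚ ∷ 1ℚ ∷ []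
      ; Y        = w ∷ s ∷ []
      ; ℓ        = ℓ (suc i)
      ; f        = f
      ; ℓ≢0      = ℓ≢0
      ; identity = identity (parameter≢0 i)
      ; n        = suc i ℕ.+ N
      ; N≤n      = ℕₚ.m≤n+m N (suc i)
      ; large    = inj₂ (solve 2 (λ w s → w :+ con 1ℚ :* (s :+ con 1ℚ :* con 0ℚ) :- (w :+ con 0ℚ :* (s :+ con 0ℚ :* con 0ℚ)) := s) refl w s)
      }
      where
      s = parameter (suc i)
      open Line A B C D E s hiding (ℓ)

    absurd-case : ℓ 1 ≡ 0ℚ → ℓ 2 ≡ 0ℚ → ℓ 3 ≡ 0ℚ → A ≡ 0ℚ × C ≡ 0ℚ × D ≡ 0ℚ
    absurd-case ℓ₁≡0 ℓ₂≡0 ℓ₃≡0 =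
      let p≡0 , β≡0 , γ≡0 = quadratic-zero p (p * B - D) (- (⅓ * (k * k))) (cube 1) (cube 2) (cube 3)
            (cube-≢ 1 2 (s≤s (s≤s z≤n))) (cube-≢ 1 3 (s≤s (s≤s z≤n))) (cube-≢ 2 3 (s≤s (s≤s (s≤s z≤n))))
            (Line.quadratic A B C D E (parameter 1) (parameter≢0 0) ℓ₁≡0)
            (Line.quadratic A B C D E (parameter 2) (parameter≢0 1) ℓ₂≡0)
            (Line.quadratic A B C D E (parameter 3) (parameter≢0 2) ℓ₃≡0)
      in  A-zero p≡0 , C-zero p≡0 γ≡0 , D-zero p≡0 β≡0
      where
      open ≡-Reasoning
      p k : ℚ
      p = ½ * A
      k = p * p - C
      A-zero : p ≡ 0ℚ → A ≡ 0ℚ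
      A-zero = *-zero-cancel ½ A λ ()
      D-zero : p ≡ 0ℚ → p * B - D ≡ 0ℚ → D ≡ 0ℚ
      D-zero p≡0 β≡0 = begin
        D           ≡⟨ p-q≡0⇒p≡q (p * B) D β≡0 ⟨
        p * B       ≡⟨ cong (_* B) p≡0 ⟩
        0ℚ * B      ≡⟨ ℚₚ.*-zeroˡ B ⟩
        0ℚ          ∎
      k-zero : - (⅓ * (k * k)) ≡ 0ℚ → k ≡ 0ℚ
      k-zero γ≡0 with k ℚₚ.≟ 0ℚ
      ... | yes k≡0 = k≡0
      ... | no  k≢0 = *-zero-cancel k k k≢0 (*-zero-cancel (- ⅓) (k * k) (λ ())
                        (trans (sym (ℚₚ.neg-distribˡ-* ⅓ (k * k))) γ≡0))
      C-zero : p ≡ 0ℚ → - (⅓ * (k * k)) ≡ 0ℚ → C ≡ 0ℚ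
      C-zero p≡0 γ≡0 = begin
        C           ≡⟨ p-q≡0⇒p≡q (p * p) C (k-zero γ≡0) ⟨
        p * p       ≡⟨ cong (λ x → x * x) p≡0 ⟩
        0ℚ          ∎

    choose : Dec (ℓ 1 ≡ 0ℚ) → Dec (ℓ 2 ≡ 0ℚ) → Dec (ℓ 3 ≡ 0ℚ) → LinearRemainder A B C D E N
    choose (no ℓ≢0)  _          _          = family 0 ℓ≢0
    choose (yes _)   (no ℓ≢0)   _          = family 1 ℓ≢0
    choose (yes _)   (yes _)    (no ℓ≢0)   = family 2 ℓ≢0
    choose (yes ℓ₁)  (yes ℓ₂)   (yes ℓ₃)   = contradiction (absurd-case ℓ₁ ℓ₂ ℓ₃) nontrivial

  -- The parameter α = 3k makes ν = α²/3 the integer 3k².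
  conicFamily : ∀ B E → B ≢ 0ℚ → ∀ N → LinearRemainder 0ℚ B 0ℚ 0ℚ E N
  conicFamily B E B≢0 N = record
    { X        = γ ∷ β ∷ α ∷ []
    ; Y        = ν ∷ 0ℚ ∷ - 1ℚ ∷ []
    ; ℓ        = num 2 * β * γ
    ; f        = γ * γ - ν * ν * ν - E
    ; ℓ≢0      = *-≢0 (num 2 * β) γ (*-≢0 (num 2) β (λ ()) β≢0) γ≢0
    ; identity = identity
    ; n        = 3 ℕ.* (suc N ℕ.* suc N)
    ; N≤n      = ℕₚ.≤-trans (ℕₚ.n≤1+n N) (ℕₚ.≤-trans (ℕₚ.m≤m*n (suc N) (suc N)) (ℕₚ.m≤n*m (suc N ℕ.* suc N) 3))
    ; large    = inj₁ (trans
        (solve 1 (λ ν → ν :+ con 0ℚ :* (con 0ℚ :+ con 0ℚ :* (con (- 1ℚ) :+ con 0ℚ :* con 0ℚ)) := ν) refl ν)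
        (sym (trans (num-* 3 (suc N ℕ.* suc N)) (cong (num 3 *_) (num-* (suc N) (suc N))))))
    }
    where
    open ≡-Reasoning
    k α σ ν β γ : ℚ
    k = num (suc N)
    α = num 3 * k
    σ = inv α
    ν = num 3 * (k * k)
    -- `β` solves 2αβ = B in degree 3, and `γ` solves β² + 2αγ + 3ν² = 0 in degree 2.
    β = ½ * B * σ
    γ = - (½ * (β * β + num 3 * (ν * ν)) * σ)

    k≢0 : k ≢ 0ℚ
    k≢0 eq with num-injective (suc N) 0 eq
    ... | ()
    α≢0 : α ≢ 0ℚ
    α≢0 = *-≢0 (num 3) k (λ ()) k≢0
    β≢0 : β ≢ 0ℚ
    β≢0 = *-≢0 (½ * B) σ (*-≢0 ½ B (λ ()) B≢0) (inv-≢0 α α≢0)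
    -- Positivity over ℚ keeps `γ`, and with it ℓ = 2βγ, away from 0.
    sum≢0 : β * β + num 3 * (ν * ν) ≢ 0ℚ
    sum≢0 eq = *-≢0 β β β≢0 β≢0 (ℚₚ.≤-antisym β²≤0 (square-nonNegative β))
      where
      3ν²≥0 : 0ℚ ℚ.≤ num 3 * (ν * ν)
      3ν²≥0 = ℚₚ.nonNegative⁻¹ (num 3 * (ν * ν))
        {{ℚₚ.nonNeg*nonNeg⇒nonNeg (num 3) (ν * ν) {{ℚ.nonNegative (square-nonNegative ν)}}}}
      β²≤0 : β * β ℚ.≤ 0ℚ
      β²≤0 = subst₂ ℚ._≤_ (ℚₚ.+-identityʳ (β * β)) eq (ℚₚ.+-monoʳ-≤ (β * β) 3ν²≥0)
    γ≢0 : γ ≢ 0ℚ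
    γ≢0 eq = *-≢0 (½ * (β * β + num 3 * (ν * ν))) σ (*-≢0 ½ _ (λ ()) sum≢0) (inv-≢0 α α≢0)
      (ℚₚ.neg-injective {_} {0ℚ} eq)

    identity : ∀ ζ → ev (γ ∷ β ∷ α ∷ []) ζ ^ℚ 2 - ev (ν ∷ 0ℚ ∷ - 1ℚ ∷ []) ζ ^ℚ 3 - gℚ 0ℚ B 0ℚ 0ℚ E ζ
      ≡ num 2 * β * γ * ζ + (γ * γ - ν * ν * ν - E)
    identity ζ = begin
      ev (γ ∷ β ∷ α ∷ []) ζ ^ℚ 2 - ev (ν ∷ 0ℚ ∷ - 1ℚ ∷ []) ζ ^ℚ 3 - gℚ 0ℚ B 0ℚ 0ℚ E ζ
        ≡⟨ expand k β γ B E ζ ⟩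
      (num 2 * α * β - B) * (ζ * ζ * ζ) + (β * β + num 2 * α * γ + num 3 * (ν * ν)) * (ζ * ζ) + rest
        ≡⟨ cong₂ (λ u v → u * (ζ * ζ * ζ) + v * (ζ * ζ) + rest) cubic≡0 square≡0 ⟩
      0ℚ * (ζ * ζ * ζ) + 0ℚ * (ζ * ζ) + rest
        ≡⟨ solve 3 (λ u v r → con 0ℚ :* u :+ con 0ℚ :* v :+ r := r) refl (ζ * ζ * ζ) (ζ * ζ) rest ⟩
      rest ∎
      where
      rest : ℚ
      rest = num 2 * β * γ * ζ + (γ * γ - ν * ν * ν - E)
      expand : ∀ k β γ B E ζ →
        let α = num 3 * k
            ν = num 3 * (k * k)
        in ev (γ ∷ β ∷ α ∷ []) ζ ^ℚ 2 - ev (ν ∷ 0ℚ ∷ - 1ℚ ∷ []) ζ ^ℚ 3 - gℚ 0ℚ B 0ℚ 0ℚ E ζ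
           ≡ (num 2 * α * β - B) * (ζ * ζ * ζ) + (β * β + num 2 * α * γ + num 3 * (ν * ν)) * (ζ * ζ)
             + (num 2 * β * γ * ζ + (γ * γ - ν * ν * ν - E))
      expand = solve 6 (λ k β γ B E ζ →
        let α = # 3 :* k
            ν = # 3 :* (k :* k)
            o = con 0ℚ
        in :lhs (γ ∷ β ∷ α ∷ []) (ν ∷ o ∷ con (- 1ℚ) ∷ []) o B o o E ζ
           := (# 2 :* α :* β :- B) :* (ζ :* ζ :* ζ) :+ (β :* β :+ # 2 :* α :* γ :+ # 3 :* (ν :* ν)) :* (ζ :* ζ)
             :+ (# 2 :* β :* γ :* ζ :+ (γ :* γ :- ν :* ν :* ν :- E))) refl
      cubic≡0 : num 2 * α * β - B ≡ 0ℚ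
      cubic≡0 = begin
        num 2 * α * (½ * B * σ) - B   ≡⟨ solve 3 (λ α B σ → # 2 :* α :* (con ½ :* B :* σ) :- B := (α :* σ :- con 1ℚ) :* B) refl α B σ ⟩
        (α * σ - 1ℚ) * B              ≡⟨ cong (λ u → (u - 1ℚ) * B) (*-inv α α≢0) ⟩
        0ℚ * B                        ≡⟨ ℚₚ.*-zeroˡ B ⟩
        0ℚ                            ∎
      square≡0 : β * β + num 2 * α * γ + num 3 * (ν * ν) ≡ 0ℚ
      square≡0 = begin
        β * β + num 2 * α * γ + num 3 * (ν * ν)
          ≡⟨ solve 4 (λ u v α σ → u :+ # 2 :* α :* (:- (con ½ :* (u :+ v) :* σ)) :+ v := (con 1ℚ :- α :* σ) :* (u :+ v))
               refl (β * β) (num 3 * (ν * ν)) α σ ⟩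
        (1ℚ - α * σ) * (β * β + num 3 * (ν * ν))   ≡⟨ cong (λ u → (1ℚ - u) * (β * β + num 3 * (ν * ν))) (*-inv α α≢0) ⟩
        0ℚ * (β * β + num 3 * (ν * ν))             ≡⟨ ℚₚ.*-zeroˡ (β * β + num 3 * (ν * ν)) ⟩
        0ℚ                                         ∎

  -- The leading coefficients 3 and 2 satisfy 3² = 2³ + 1.
  cubicFamily : ∀ E N → LinearRemainder 0ℚ 0ℚ 0ℚ 0ℚ E N
  cubicFamily E N = record
    { X        = num 12 * (k * k * k) ∷ num 24 * (k * k) ∷ num 12 * k ∷ num 3 ∷ []
    ; Y        = num 6 * (k * k) ∷ num 6 * k ∷ num 2 ∷ []
    -- This is -72k⁵, bracketed as a product of nonzero factors.
    ; ℓ        = num 72 * (- k * (k * k * (k * k)))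
    ; f        = - (num 72 * (k * k * k * (k * k * k))) - E
    ; ℓ≢0      = *-≢0 (num 72) _ (λ ()) (*-≢0 (- k) _ -k≢0
                   (*-≢0 (k * k) (k * k) (*-≢0 k k k≢0 k≢0) (*-≢0 k k k≢0 k≢0)))
    ; identity = identity k E
    ; n        = 2 ℕ.+ 6 ℕ.* suc N
    ; N≤n      = ℕₚ.≤-trans (ℕₚ.n≤1+n N) (ℕₚ.≤-trans (ℕₚ.m≤n*m (suc N) 6) (ℕₚ.m≤n+m (6 ℕ.* suc N) 2))
    ; large    = inj₂ (trans (difference k)
                   (sym (trans (num-+ 2 (6 ℕ.* suc N)) (cong (_+_ (num 2)) (num-* 6 (suc N))))))
    }
    where
    k : ℚ
    k = num (suc N)
    k≢0 : k ≢ 0ℚ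
    k≢0 eq with num-injective (suc N) 0 eq
    ... | ()
    -k≢0 : - k ≢ 0ℚ
    -k≢0 eq = k≢0 (ℚₚ.neg-injective {k} {0ℚ} eq)
    difference : ∀ k → let Y = num 6 * (k * k) ∷ num 6 * k ∷ num 2 ∷ [] in
      ev Y 1ℚ - ev Y 0ℚ ≡ num 2 + num 6 * k
    difference = solve 1 (λ k → let Y = # 6 :* (k :* k) ∷ # 6 :* k ∷ # 2 ∷ [] in
      :ev Y (con 1ℚ) :- :ev Y (con 0ℚ) := # 2 :+ # 6 :* k) refl
    identity : ∀ k E ζ →
      ev (num 12 * (k * k * k) ∷ num 24 * (k * k) ∷ num 12 * k ∷ num 3 ∷ []) ζ ^ℚ 2
        - ev (num 6 * (k * k) ∷ num 6 * k ∷ num 2 ∷ []) ζ ^ℚ 3 - gℚ 0ℚ 0ℚ 0ℚ 0ℚ E ζ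
      ≡ num 72 * (- k * (k * k * (k * k))) * ζ + (- (num 72 * (k * k * k * (k * k * k))) - E)
    identity = solve 3 (λ k E ζ → let o = con 0ℚ in
      :lhs (# 12 :* (k :* k :* k) ∷ # 24 :* (k :* k) ∷ # 12 :* k ∷ # 3 ∷ []) (# 6 :* (k :* k) ∷ # 6 :* k ∷ # 2 ∷ []) o o o o E ζ
      := # 72 :* (:- k :* (k :* k :* (k :* k))) :* ζ :+ (:- (# 72 :* (k :* k :* k :* (k :* k :* k))) :- E)) refl

  linearRemainder : ∀ A B C D E N → LinearRemainder A B C D E N
  linearRemainder A B C D E N with A ℚₚ.≟ 0ℚ | C ℚₚ.≟ 0ℚ | D ℚₚ.≟ 0ℚ | B ℚₚ.≟ 0ℚ
  ... | no A≢0   | _        | _        | _        = lineFamily A B C D E (λ (A≡0 , _) → A≢0 A≡0) N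
  ... | yes _    | no C≢0   | _        | _        = lineFamily A B C D E (λ (_ , C≡0 , _) → C≢0 C≡0) N
  ... | yes _    | yes _    | no D≢0   | _        = lineFamily A B C D E (λ (_ , _ , D≡0) → D≢0 D≡0) N
  ... | yes refl | yes refl | yes refl | no B≢0   = conicFamily B E B≢0 N
  ... | yes refl | yes refl | yes refl | yes refl = cubicFamily E N

-- Infinitely many solutions, and the final statement.

infinitely-many-solutions : ∀ a b c d e → Infinite ℚ[t]³-setoid (IsSolution a b c d e)
infinitely-many-solutions a b c d e = Solutions.infinitely-many a b c d e
  (Families.linearRemainder (fromℤ a) (fromℤ b) (fromℤ c) (fromℤ d) (fromℤ e))

open import Data.Integer.Base using (_-_)

theorem4p1 : (a b c d e : ℤ) →
    (Infinite ℚ²-setoid (OnC a b c) → Infinite ℚ[t]³-setoid (IsSolution a b c d e)) ×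
    (b ≢ 0ℤ → + 2 ∣ a - 1ℤ → Infinite ℚ²-setoid (OnC a b c) × Infinite ℚ[t]³-setoid (IsSolution a b c d e))
theorem4p1 a b c d e =
  (λ _ → infinitely-many-solutions a b c d e) ,
  (λ b≢0 a-odd → CurvePoints.infinitely-many-points a b c b≢0 a-odd , infinitely-many-solutions a b c d e)
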